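{- Let $k$ be a field and let $M$ be a regular matroid of rank $r$ on ground set $E=\{e_1,\ldots,e_n\}$, with a basis $B=\{e_{n-r+1},\ldots,e_n\}$. Let $(a^*_{ji})$ be an admissibly signed fundamental cocircuit incidence matrix of $M$ with respect to $B$ over $k$, with row $j$ corresponding to $\mathrm{coc}(B,e_j)$ and column $i$ to $e_i$. For $e_j\in B$ set \[\theta_{e_j}=\sum_{e_i\in\mathrm{coc}(B,e_j)}a^*_{ji}x_i\in k[x_1,\ldots,x_n].\] Then $\Theta^B=\{\theta_e\mid e\in B\}$ is a linear system of parameters for both $k[\mathcal{I}(M)]$ and $k[\Delta_{\mathrm{BC}}(M)]$.
   Context: For $b\in B$, the fundamental cocircuit $\mathrm{coc}(B,b)$ is the unique cocircuit of $M$ (circuit of the dual matroid) contained in $(E\setminus B)\cup\{b\}$. The cocircuit incidence matrix has rows indexed by cocircuits, columns by $e_1,\ldots,e_n$, entries $1$ if the element lies in the cocircuit and $0$ otherwise; the circuit incidence matrix is defined analogously with circuits. A signing replaces some entries $1$ by $-1$; a signing of the cocircuit incidence matrix is admissible over $k$ if some signing of the circuit incidence matrix makes (signed circuit matrix)$\cdot$(signed cocircuit matrix)$^T=0$ over $k$. The admissibly signed fundamental cocircuit incidence matrix w.r.t. $B$ is the submatrix of rows of the fundamental cocircuits $\mathrm{coc}(B,e_j)$, $e_j\in B$. $\mathcal{I}(M)$ is the independence complex of $M$. The broken circuit complex $\Delta_{\mathrm{BC}}(M)$ (w.r.t. the order $e_1<\cdots<e_n$) consists of all subsets of $E$ containing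 no broken circuit $C\setminus\{\min C\}$, $C$ a circuit of $M$. For a simplicial complex $\Delta$ on $[n]$, $k[\Delta]=k[x_1,\ldots,x_n]/I_\Delta$ with $I_\Delta$ generated by the monomials $\prod_{i\in F}x_i$, $F\notin\Delta$. A linear system of parameters for $k[\Delta]$ with $\dim\Delta=d-1$ is a set of $d$ linear forms $\theta_1,\ldots,\theta_d$ such that $k[\Delta]$ is a finitely generated $k[\theta_1,\ldots,\theta_d]$-module. A matroid is regular if representable by a matrix whose square submatrices all have determinant in $\{ -1,0,1\}$.
   Formalization: The claim for k[Δ_BC(M)] is stated only for matroids M without loops: if M has a loop, the empty set is a broken circuit, Δ_BC(M) has no faces at all, and a linear system of parameters is not defined; the claim for k[I(M)] is unrestricted. -}

module Defs where

open import Level using (Level; _⊔_) renaming (suc to lsuc; zero to 0ℓ)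
open import Data.Bool using (Bool; true; false; if_then_else_)
open import Data.Nat using (ℕ; zero; suc; _≤_) renaming (_+_ to _+ℕ_; _≟_ to _≟ℕ_)
open import Data.Fin using (Fin; zero; suc; punchIn)
open import Data.Fin.Subset using (Subset; _∈_; _∉_; _⊆_; _⊂_; ∁; _∪_; ⁅_⁆; ∣_∣)
open import Data.Vec using (Vec; []; _∷_; lookup; replicate; zipWith; tabulate)
  renaming (_++_ to _++ᵛ_)
open import Data.Vec.Properties using (≡-dec)
open import Data.List using (List; []; _∷_; map; concatMap; _++_)
open import Data.List.Relation.Unary.All using (All)
open import Data.Product using (Σ; ∃; ∃-syntax; _×_; _,_)
open import Data.Sum using (_⊎_)
open import Data.Sign using (Sign)
open import Data.Rational using (ℚ; 0ℚ; 1ℚ) renaming (_+_ to _+ℚ_; _*_ to _*ℚ_; -_ to -ℚ_)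
open import Relation.Nullary using (¬_; ⌊_⌋)
open import Relation.Binary.PropositionalEquality using (_≡_)
open import Function.Definitions using (Injective)
open import Algebra.Bundles using (CommutativeRing)

record Field c ℓ : Set (lsuc (c ⊔ ℓ)) where
  field
    commutativeRing : CommutativeRing c ℓ
  open CommutativeRing commutativeRing public
  field
    1≉0     : ¬ (1# ≈ 0#)
    inverse : ∀ x → ¬ (x ≈ 0#) → ∃[ y ] (x * y ≈ 1#)

-- Matroids on the ground set E = Fin n  (element i : Fin n is e_{i+1};
-- the order e_1 < ... < e_n is the order of Fin n), given by independent sets.

record Matroid (n : ℕ) : Set₁ where
  field
    Indep : Subset n → Set
    indep-∅   : Indep Data.Fin.Subset.⊥
    indep-⊆   : ∀ {X Y} → X ⊆ Y → Indep Y → Indep X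
    indep-aug : ∀ {X Y} → Indep X → Indep Y → ∣ X ∣ Data.Nat.< ∣ Y ∣ →
                ∃[ e ] (e ∈ Y × e ∉ X × Indep (X ∪ ⁅ e ⁆))

module _ {n : ℕ} (M : Matroid n) where
  open Matroid M

  IsBasis : Subset n → Set
  IsBasis B = Indep B × (∀ X → B ⊂ X → ¬ Indep X)

  IsCircuitOf : (Subset n → Set) → Subset n → Set
  IsCircuitOf I C = ¬ I C × (∀ D → D ⊂ C → I D)

  IsCircuit : Subset n → Set
  IsCircuit = IsCircuitOf Indep

  IndepDual : Subset n → Set
  IndepDual X = ∃[ B ] (IsBasis B × X ⊆ ∁ B)

  IsCocircuit : Subset n → Set
  IsCocircuit = IsCircuitOf IndepDual

  IsFundCocircuit : Subset n → Fin n → Subset n → Set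
  IsFundCocircuit B b C = IsCocircuit C × C ⊆ (∁ B ∪ ⁅ b ⁆)

  Loopless : Set
  Loopless = ∀ i → Indep ⁅ i ⁆

-- Regular matroids: representable over ℚ by a totally unimodular matrix.
-- (A real matrix all of whose square minors lie in {-1,0,1} has entries in
-- {-1,0,1}, so it is rational, and real/rational independence coincide.)

∑ℚ : ∀ {n} → (Fin n → ℚ) → ℚ
∑ℚ {zero}  f = 0ℚ
∑ℚ {suc n} f = f zero +ℚ ∑ℚ (λ i → f (suc i))

det : ∀ s → (Fin s → Fin s → ℚ) → ℚ
det zero    A = 1ℚ
det (suc s) A = go s A
  where
  altsum : ∀ {t} → Bool → (Fin t → ℚ) → ℚ
  altsum {zero}  b f = 0ℚ
  altsum {suc t} b f = (if b then f zero else -ℚ f zero) +ℚ altsum (if b then false else true) (λ i → f (suc i))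
  go : ∀ s → (Fin (suc s) → Fin (suc s) → ℚ) → ℚ
  go s A = altsum true (λ j → A zero j *ℚ det s (λ a b → A (suc a) (punchIn j b)))

TotallyUnimodular : ∀ {p n} → (Fin p → Fin n → ℚ) → Set
TotallyUnimodular {p} {n} A =
  ∀ s (ρ : Fin s → Fin p) (κ : Fin s → Fin n) → Injective _≡_ _≡_ ρ → Injective _≡_ _≡_ κ →
  let d = det s (λ a b → A (ρ a) (κ b)) in
  (d ≡ -ℚ 1ℚ) ⊎ (d ≡ 0ℚ) ⊎ (d ≡ 1ℚ)

ColumnsIndependent : ∀ {p n} → (Fin p → Fin n → ℚ) → Subset n → Set
ColumnsIndependent {p} {n} A X =
  ∀ (λ′ : Fin n → ℚ) → (∀ i → i ∉ X → λ′ i ≡ 0ℚ) →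
  (∀ a → ∑ℚ (λ i → λ′ i *ℚ A a i) ≡ 0ℚ) → ∀ i → λ′ i ≡ 0ℚ

Regular : ∀ {n} → Matroid n → Set
Regular {n} M = ∃[ p ] Σ (Fin p → Fin n → ℚ) λ A →
  TotallyUnimodular A ×
  (∀ X → (Matroid.Indep M X → ColumnsIndependent A X) × (ColumnsIndependent A X → Matroid.Indep M X))

module OverField {c ℓ} (K : Field c ℓ) where
  open Field K using (Carrier; _≈_; _+_; _*_; -_; 0#; 1#)

  ∑ : ∀ {n} → (Fin n → Carrier) → Carrier
  ∑ {zero}  f = 0#
  ∑ {suc n} f = f zero + ∑ (λ i → f (suc i))

  signVal : Sign → Carrier
  signVal Sign.+ = 1#
  signVal Sign.- = - 1#

  -- a signing of an incidence matrix whose rows are indexed by subsets of E: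
  -- the sign chosen for entry (row C, column i); the entry of the signed
  -- matrix is ±1 if i ∈ C and 0 otherwise.
  Signing : ℕ → Set
  Signing n = Subset n → Fin n → Sign

  entry : ∀ {n} → Signing n → Subset n → Fin n → Carrier
  entry σ C i = if lookup C i then signVal (σ C i) else 0#

  Admissible : ∀ {n} → Matroid n → Signing n → Set ℓ
  Admissible M σ = ∃[ τ ] (∀ D C → IsCircuit M D → IsCocircuit M C →
                     ∑ (λ i → entry τ D i * entry σ C i) ≈ 0#)

  Poly : ℕ → Set c
  Poly n = List (Carrier × Vec ℕ n)

  coeff : ∀ {n} → Poly n → Vec ℕ n → Carrier
  coeff []            α = 0#
  coeff ((a , β) ∷ p) α = (if ⌊ ≡-dec _≟ℕ_ β α ⌋ then a else 0#) + coeff p α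

  _≈ₚ_ : ∀ {n} → Poly n → Poly n → Set ℓ
  p ≈ₚ q = ∀ α → coeff p α ≈ coeff q α

  _+ₚ_ : ∀ {n} → Poly n → Poly n → Poly n
  _+ₚ_ = _++_

  -ₚ_ : ∀ {n} → Poly n → Poly n
  -ₚ p = map (λ { (a , α) → (- a , α) }) p

  _*ₚ_ : ∀ {n} → Poly n → Poly n → Poly n
  p *ₚ q = concatMap (λ { (a , α) → map (λ { (b , β) → (a * b , zipWith _+ℕ_ α β) }) q }) p

  0ₚ : ∀ {n} → Poly n
  0ₚ = []

  1ₚ : ∀ {n} → Poly n
  1ₚ = (1# , replicate _ 0) ∷ []

  _^ₚ_ : ∀ {n} → Poly n → ℕ → Poly n
  p ^ₚ zero  = 1ₚ
  p ^ₚ suc k = p *ₚ (p ^ₚ k)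

  ∑ₚ : ∀ {n m} → (Fin m → Poly n) → Poly n
  ∑ₚ {m = zero}  f = 0ₚ
  ∑ₚ {m = suc m} f = f zero +ₚ ∑ₚ (λ i → f (suc i))

  unitExp : ∀ {n} → Fin n → Vec ℕ n
  unitExp i = tabulate (λ j → if ⌊ i Data.Fin.≟ j ⌋ then 1 else 0)

  linForm : ∀ {n} → (Fin n → Carrier) → Poly n
  linForm a = ∑ₚ (λ i → (a i , unitExp i) ∷ [])

  monoSubst : ∀ {n d} → Vec ℕ d → (Fin d → Poly n) → Poly n
  monoSubst []      θ = 1ₚ
  monoSubst (a ∷ α) θ = (θ zero ^ₚ a) *ₚ monoSubst α (λ j → θ (suc j))

  evalAt : ∀ {n d} → Poly d → (Fin d → Poly n) → Poly n
  evalAt []            θ = 0ₚ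
  evalAt ((a , α) ∷ p) θ = (((a , replicate _ 0) ∷ []) *ₚ monoSubst α θ) +ₚ evalAt p θ

  xMon : ∀ {n} → Subset n → Poly n
  xMon F = (1# , Data.Vec.map (λ b → if b then 1 else 0) F) ∷ []

  InSRIdeal : ∀ {n} → (Subset n → Set) → Poly n → Set (c ⊔ ℓ)
  InSRIdeal {n} Δ f = ∃[ m ] Σ (Fin m → Poly n) λ h → Σ (Fin m → Subset n) λ F →
    (∀ l → ¬ Δ (F l)) × (f ≈ₚ ∑ₚ (λ l → h l *ₚ xMon (F l)))

  FinGenOver : ∀ {n d} → (Subset n → Set) → (Fin d → Poly n) → Set (c ⊔ ℓ)
  FinGenOver {n} {d} Δ θ = ∃[ m ] Σ (Fin m → Poly n) λ g → ∀ (f : Poly n) →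
    Σ (Fin m → Poly d) λ p → InSRIdeal Δ (f +ₚ (-ₚ ∑ₚ (λ l → evalAt (p l) θ *ₚ g l)))

  HasDim-1 : ∀ {n} → (Subset n → Set) → ℕ → Set
  HasDim-1 Δ d = (∀ F → Δ F → ∣ F ∣ ≤ d) × ∃[ F ] (Δ F × ∣ F ∣ ≡ d)

  IsLSOP : ∀ {n d} → (Subset n → Set) → (Fin d → Fin n → Carrier) → Set (c ⊔ ℓ)
  IsLSOP {n} {d} Δ a = HasDim-1 Δ d × FinGenOver Δ (λ j → linForm (a j))

IndepComplex : ∀ {n} → Matroid n → Subset n → Set
IndepComplex M = Matroid.Indep M

removeMin : ∀ {n} → Subset n → Subset n
removeMin []          = []
removeMin (true ∷ C)  = false ∷ C
removeMin (false ∷ C) = false ∷ removeMin C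

BCComplex : ∀ {n} → Matroid n → Subset n → Set
BCComplex M F = ∀ C → IsCircuit M C → ¬ (removeMin C ⊆ F)

lastBlock : ∀ m r → Subset (m +ℕ r)
lastBlock m r = replicate m false ++ᵛ replicate r true

{-# OPTIONS --safe #-}
module Submission where

-- Every signed cocircuit vector lies in the span of the signed fundamental
-- ones: after subtracting the combination that agrees with it on B, it is still
-- orthogonal to the signed fundamental circuits of B, hence zero. Applied to a
-- fundamental cocircuit of a basis containing an independent set F, this yields,
-- for each f ∈ F, a linear form in the span of Θ whose restriction to F is x_f.
-- With it one factor x_f of a monomial that has support F and is divisible by
-- x_f² can be replaced by elements of Θ and variables outside F; induction on the
-- degree and on the size of the complement of the support shows that the
-- squarefree monomials generate k[I(M)] over k[Θ]. Each dependent set contains a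
-- broken circuit, so the same holds for k[Δ_BC(M)]; its dimension is attained
-- at the lexicographically first basis, which contains no broken circuit because
-- M has no loops. Representability over ℚ enters only through the decidability
-- of independence.

open import Defs
open import Level using (_⊔_)
open import Algebra.Bundles using (CommutativeRing; CommutativeMonoid)
open import Data.Bool using (Bool; true; false; if_then_else_)
open import Data.Fin using (Fin; zero; suc; _↑ˡ_; _↑ʳ_; splitAt)
import Data.Fin as Fin
import Data.Fin.Properties as Finₚ
open import Data.Fin.Subset
  using (Subset; _∈_; _∉_; _⊆_; _⊂_; ∁; _∪_; _─_; _-_; ⁅_⁆; ∣_∣; inside; outside; ⊥)
open import Data.Fin.Subset.Properties
open import Data.List using (List; []; _∷_; _++_; length)
import Data.List as List
open import Data.List.Membership.Propositional.Properties using (∈-++⁺ˡ; ∈-++⁺ʳ; ∈-map⁺)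
import Data.List.Membership.Propositional as Membership
import Data.List.Relation.Unary.Any as Any
open import Data.List.Relation.Unary.Any.Properties using (lookup-index)
open import Data.Nat using (ℕ; zero; suc; _≤_; _<_; s≤s; z≤n) renaming (_+_ to _+ℕ_; _≟_ to _≟ℕ_)
import Data.Nat as ℕ
import Data.Nat.Properties as ℕₚ
open import Data.Product using (Σ; ∃-syntax; _×_; _,_; proj₁; proj₂)
open import Data.Rational using (ℚ; 0ℚ; 1ℚ; 1/_; NonZero; ≢-nonZero)
  renaming (_+_ to _+ℚ_; _*_ to _*ℚ_; -_ to -ℚ_; _-_ to _−ℚ_)
import Data.Rational.Properties as ℚₚ
open import Data.Rational.Solver using (module +-*-Solver)
open import Data.Sign using (Sign)
open import Data.Sum using (_⊎_; inj₁; inj₂; [_,_]′)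
open import Data.Vec using (Vec; []; _∷_; lookup; tabulate; replicate; zipWith; updateAt; here; there)
import Data.Vec as Vec
open import Data.Vec.Properties
  using ( ≡-dec; lookup⇒[]=; []=⇒lookup; lookup∘tabulate; tabulate-cong; lookup-++ˡ; lookup-++ʳ
        ; lookup-replicate; zipWith-assoc; zipWith-comm; zipWith-identityˡ)
open import Function using (_∘_)
open import Relation.Binary.PropositionalEquality as ≡ using (_≡_; _≢_; cong; cong₂; subst)
import Relation.Binary.Reasoning.Setoid as SetoidReasoning
open import Relation.Nullary using (¬_; Dec; yes; no; does; contradiction; ¬?; _×-dec_; ⌊_⌋; isYes)
open import Relation.Nullary.Decidable using (decidable-stable; ⌊⌋-map′)

-- Subsets of a finite set, their sizes and their minima.

x∈q⇒x∉p─q : ∀ {n} {x : Fin n} (p q : Subset n) → x ∈ q → x ∉ p ─ q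
x∈q⇒x∉p─q (_ ∷ p) (_ ∷ q) here ()
x∈q⇒x∉p─q (_ ∷ p) (inside ∷ q) (there x∈q) (there x∈) = x∈q⇒x∉p─q p q x∈q x∈
x∈q⇒x∉p─q (_ ∷ p) (outside ∷ q) (there x∈q) (there x∈) = x∈q⇒x∉p─q p q x∈q x∈

x∈p-y⇒x∈p : ∀ {n} {x y : Fin n} (p : Subset n) → x ∈ p - y → x ∈ p
x∈p-y⇒x∈p {y = y} p = p─q⊆p p ⁅ y ⁆

x∈p-y⇒x≢y : ∀ {n} {x y : Fin n} (p : Subset n) → x ∈ p - y → x ≢ y
x∈p-y⇒x≢y {x = x} p x∈ ≡.refl = x∈q⇒x∉p─q p ⁅ x ⁆ (x∈⁅x⁆ x) x∈

x∈p∪⁅y⁆⁻ : ∀ {n} {x y : Fin n} (p : Subset n) → x ∈ p ∪ ⁅ y ⁆ → x ∈ p ⊎ x ≡ y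
x∈p∪⁅y⁆⁻ {y = y} p x∈ with x∈p∪q⁻ p ⁅ y ⁆ x∈
... | inj₁ x∈p = inj₁ x∈p
... | inj₂ x∈y = inj₂ (x∈⁅y⁆⇒x≡y y x∈y)

y∈p∪⁅y⁆ : ∀ {n} (y : Fin n) (p : Subset n) → y ∈ p ∪ ⁅ y ⁆
y∈p∪⁅y⁆ y p = q⊆p∪q p ⁅ y ⁆ (x∈⁅x⁆ y)

∪⁅⁆-⊆ : ∀ {n} {y : Fin n} {p q : Subset n} → p ⊆ q → y ∈ q → p ∪ ⁅ y ⁆ ⊆ q
∪⁅⁆-⊆ {p = p} p⊆q y∈q x∈ with x∈p∪⁅y⁆⁻ p x∈
... | inj₁ x∈p  = p⊆q x∈p
... | inj₂ ≡.refl = y∈q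

∣p∪⁅x⁆∣≡1+∣p∣ : ∀ {n} {x : Fin n} (p : Subset n) → x ∉ p → ∣ p ∪ ⁅ x ⁆ ∣ ≡ suc ∣ p ∣
∣p∪⁅x⁆∣≡1+∣p∣ {x = zero}  (inside  ∷ p) x∉ = contradiction here x∉
∣p∪⁅x⁆∣≡1+∣p∣ {x = zero}  (outside ∷ p) x∉ = cong (suc ∘ ∣_∣) (∪-identityʳ p)
∣p∪⁅x⁆∣≡1+∣p∣ {x = suc x} (inside  ∷ p) x∉ = cong suc (∣p∪⁅x⁆∣≡1+∣p∣ p (x∉ ∘ there))
∣p∪⁅x⁆∣≡1+∣p∣ {x = suc x} (outside ∷ p) x∉ = ∣p∪⁅x⁆∣≡1+∣p∣ p (x∉ ∘ there)

1+∣p-x∣≡∣p∣ : ∀ {n} {x : Fin n} (p : Subset n) → x ∈ p → suc ∣ p - x ∣ ≡ ∣ p ∣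
1+∣p-x∣≡∣p∣ (inside ∷ p) here = cong (suc ∘ ∣_∣) (p─⊥≡p p)
1+∣p-x∣≡∣p∣ (inside  ∷ p) (there x∈) = cong suc (1+∣p-x∣≡∣p∣ p x∈)
1+∣p-x∣≡∣p∣ (outside ∷ p) (there x∈) = 1+∣p-x∣≡∣p∣ p x∈

p⊆q∧∣p∣≡∣q∣⇒q⊆p : ∀ {n} {p q : Subset n} → p ⊆ q → ∣ p ∣ ≡ ∣ q ∣ → q ⊆ p
p⊆q∧∣p∣≡∣q∣⇒q⊆p {p = p} p⊆q eq {x} x∈q with x ∈? p
... | yes x∈p = x∈p
... | no  x∉p = contradiction (p⊂q⇒∣p∣<∣q∣ (p⊆q , x , x∈q , x∉p)) (ℕₚ.<-irrefl eq)

filter : ∀ {n} {P : Fin n → Set} → (∀ x → Dec (P x)) → Subset n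
filter P? = tabulate (isYes ∘ P?)

x∈filter⁺ : ∀ {n} {P : Fin n → Set} (P? : ∀ x → Dec (P x)) {x} → P x → x ∈ filter P?
x∈filter⁺ P? {x} Px = lookup⇒[]= x _ (≡.trans (lookup∘tabulate _ x) (yes-true (P? x) Px))
  where
  yes-true : ∀ {A : Set} (d : Dec A) → A → isYes d ≡ true
  yes-true (yes _) _ = ≡.refl
  yes-true (no ¬a) a = contradiction a ¬a

x∈filter⁻ : ∀ {n} {P : Fin n → Set} (P? : ∀ x → Dec (P x)) {x} → x ∈ filter P? → P x
x∈filter⁻ P? {x} x∈ = true-yes (P? x) (≡.trans (≡.sym (lookup∘tabulate _ x)) ([]=⇒lookup x∈))
  where
  true-yes : ∀ {A : Set} (d : Dec A) → isYes d ≡ true → A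
  true-yes (yes a) _ = a
  true-yes (no _) ()

⊈⇒∃ : ∀ {n} (p q : Subset n) → ¬ (p ⊆ q) → ∃[ x ] (x ∈ p × x ∉ q)
⊈⇒∃ p q p⊈q with Finₚ.any? (λ x → (x ∈? p) ×-dec ¬? (x ∈? q))
... | yes w  = w
... | no ¬w = contradiction (λ {x} x∈p → decidable-stable (x ∈? q) λ x∉q → ¬w (x , x∈p , x∉q)) p⊈q

removeMin⊆ : ∀ {n} (C : Subset n) → removeMin C ⊆ C
removeMin⊆ (true  ∷ C) (there x∈) = there x∈
removeMin⊆ (false ∷ C) (there x∈) = there (removeMin⊆ C x∈)

-- The element `x` certifies that `C` is nonempty, so that a minimum `c` exists. The last two
-- components are the only facts about a broken circuit used later: it lies strictly above `c`, and
-- it misses nothing of `C` but `c`.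
removeMin-min : ∀ {n} (C : Subset n) {x : Fin n} → x ∈ C → ∃[ c ] (c ∈ C ×
  (∀ y → y ∈ removeMin C → c Fin.< y) × (∀ y → y ∈ C → y ≢ c → y ∈ removeMin C))
removeMin-min (true ∷ C) _ = zero , here , (λ { (suc y) _ → s≤s z≤n }) ,
  λ { zero _ y≢ → contradiction ≡.refl y≢ ; (suc y) (there y∈) _ → there y∈ }
removeMin-min (false ∷ C) (there x∈) =
  let c , c∈ , lt , rest = removeMin-min C x∈ in
  suc c , there c∈ , (λ { (suc y) (there y∈) → s≤s (lt y y∈) }) ,
  λ { (suc y) (there y∈) y≢ → there (rest y y∈ (y≢ ∘ cong suc)) }

-- Bases, circuits, cocircuits and broken circuits of a matroid.

module _ {n : ℕ} (M : Matroid n) where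
  open Matroid M

  -- Iterated augmentation of `X` by elements of `Y`; the counter of `go` is the number of elements
  -- still missing. The bound `Z ⊆ X ∪ Y` records where the new elements come from, which the
  -- exchange argument in `lexfirst∈BC` relies on.
  extend : ∀ {X Y} → Indep X → Indep Y → ∣ X ∣ ≤ ∣ Y ∣ →
           ∃[ Z ] (X ⊆ Z × Z ⊆ X ∪ Y × Indep Z × ∣ Z ∣ ≡ ∣ Y ∣)
  extend {X} {Y} iX iY X≤Y = go (∣ Y ∣ ℕ.∸ ∣ X ∣) X iX (ℕₚ.m∸n+n≡m X≤Y) (λ x → x) (p⊆p∪q Y)
    where
    go : ∀ k Z → Indep Z → k +ℕ ∣ Z ∣ ≡ ∣ Y ∣ → X ⊆ Z → Z ⊆ X ∪ Y →
         ∃[ Z ] (X ⊆ Z × Z ⊆ X ∪ Y × Indep Z × ∣ Z ∣ ≡ ∣ Y ∣)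
    go zero    Z iZ eq X⊆Z Z⊆ = Z , X⊆Z , Z⊆ , iZ , eq
    go (suc k) Z iZ eq X⊆Z Z⊆ with indep-aug iZ iY (subst (∣ Z ∣ <_) eq (s≤s (ℕₚ.m≤n+m _ k)))
    ... | e , e∈Y , e∉Z , iZe = go k (Z ∪ ⁅ e ⁆) iZe
      (≡.trans (cong (k +ℕ_) (∣p∪⁅x⁆∣≡1+∣p∣ Z e∉Z)) (≡.trans (ℕₚ.+-suc k _) eq))
      (p⊆p∪q _ ∘ X⊆Z) (∪⁅⁆-⊆ Z⊆ (q⊆p∪q X Y e∈Y))

  basis-dependent : ∀ {B e} → IsBasis M B → e ∉ B → ¬ Indep (B ∪ ⁅ e ⁆)
  basis-dependent {B} {e} (_ , max) e∉B =
    max _ (p⊆p∪q ⁅ e ⁆ , e , y∈p∪⁅y⁆ e B , e∉B)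

  indep-size : ∀ {B X} → IsBasis M B → Indep X → ∣ X ∣ ≤ ∣ B ∣
  indep-size {B} {X} bB iX with ∣ X ∣ ℕ.≤? ∣ B ∣
  ... | yes le = le
  ... | no  gt with indep-aug (proj₁ bB) iX (ℕₚ.≰⇒> gt)
  ...   | e , _ , e∉B , iBe = contradiction iBe (basis-dependent bB e∉B)

  indep-of-basis-size : ∀ {B X} → IsBasis M B → Indep X → ∣ X ∣ ≡ ∣ B ∣ → IsBasis M X
  indep-of-basis-size bB iX eq = iX , λ Y X⊂Y iY →
    ℕₚ.<⇒≱ (p⊂q⇒∣p∣<∣q∣ X⊂Y) (subst (∣ Y ∣ ≤_) (≡.sym eq) (indep-size bB iY))

  extend-to-basis : ∀ {B X} → IsBasis M B → Indep X → ∃[ B′ ] (X ⊆ B′ × IsBasis M B′)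
  extend-to-basis bB iX =
    let Z , X⊆Z , _ , iZ , eq = extend iX (proj₁ bB) (indep-size bB iX) in
    Z , X⊆Z , indep-of-basis-size bB iZ eq

  basis-size : ∀ {B B′} → IsBasis M B → IsBasis M B′ → ∣ B ∣ ≡ ∣ B′ ∣
  basis-size b b′ = ℕₚ.≤-antisym (indep-size b′ (proj₁ b)) (indep-size b (proj₁ b′))

  module _ (indep? : ∀ X → Dec (Indep X)) where

    -- Elements are deleted as long as the rest stays dependent. When no deletion keeps dependence,
    -- every proper subset lies in some independent `X - x`, so `X` is a circuit. The number `k`
    -- bounds the size and makes the recursion terminate.
    dependent⇒circuit : ∀ X → ¬ Indep X → ∃[ C ] (C ⊆ X × IsCircuit M C)
    dependent⇒circuit X ¬iX = go ∣ X ∣ X ¬iX ℕₚ.≤-refl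
      where
      go : ∀ k X → ¬ Indep X → ∣ X ∣ ≤ k → ∃[ C ] (C ⊆ X × IsCircuit M C)
      go k X ¬iX X≤k with Finₚ.any? (λ x → (x ∈? X) ×-dec ¬? (indep? (X - x)))
      go zero X ¬iX X≤k | yes (x , x∈X , ¬i) =
        contradiction (ℕₚ.≤-trans (x∈p⇒∣p-x∣<∣p∣ x∈X) X≤k) λ ()
      go (suc k) X ¬iX X≤k | yes (x , x∈X , ¬i) =
        let C , C⊆ , cC = go k (X - x) ¬i (ℕₚ.≤-pred (ℕₚ.≤-trans (x∈p⇒∣p-x∣<∣p∣ x∈X) X≤k)) in
        C , x∈p-y⇒x∈p X ∘ C⊆ , cC
      ... | no none = X , (λ x → x) , ¬iX , λ { D (D⊆X , x , x∈X , x∉D) →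
        indep-⊆ (λ {y} y∈D → x∈p∧x≢y⇒x∈p-y (D⊆X y∈D) λ { ≡.refl → x∉D y∈D })
                (decidable-stable (indep? (X - x)) λ ¬i → none (x , x∈X , ¬i)) }

    fundamental-circuit : ∀ {B e} → IsBasis M B → e ∉ B →
                          ∃[ C ] (C ⊆ B ∪ ⁅ e ⁆ × e ∈ C × IsCircuit M C)
    fundamental-circuit {B} {e} bB e∉B =
      let C , C⊆ , cC = dependent⇒circuit _ (basis-dependent bB e∉B) in
      C , C⊆ , decidable-stable (e ∈? C) (λ e∉C → proj₁ cC
        (indep-⊆ (λ {x} x∈C → [ (λ x∈B → x∈B) , (λ { ≡.refl → contradiction x∈C e∉C }) ]′
                                 (x∈p∪⁅y⁆⁻ B (C⊆ x∈C)))
                 (proj₁ bB))) , cC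

    -- The witness `C` is the complement of the hyperplane spanned by `B - f`: it consists of the
    -- elements by which `H` can be completed to a basis.
    fundamental-cocircuit : ∀ {B f} → IsBasis M B → f ∈ B →
      ∃[ C ] (f ∈ C × (∀ {x} → x ∈ C → x ∈ B → x ≡ f) × IsCocircuit M C)
    fundamental-cocircuit {B} {f} bB f∈B = C , f∈C , C∩B , ¬dual , minimal
      where
      H = B - f
      P? = λ e → ¬? (e ∈? H) ×-dec indep? (H ∪ ⁅ e ⁆)
      C = filter P?
      H⊆B : H ⊆ B
      H⊆B = x∈p-y⇒x∈p B
      f∈C : f ∈ C
      f∈C = x∈filter⁺ P? ((λ f∈H → x∈p-y⇒x≢y B f∈H ≡.refl) , indep-⊆ (∪⁅⁆-⊆ H⊆B f∈B) (proj₁ bB))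
      C∩B : ∀ {x} → x ∈ C → x ∈ B → x ≡ f
      C∩B {x} x∈C x∈B = decidable-stable (x Fin.≟ f) λ x≢f →
        proj₁ (x∈filter⁻ P? x∈C) (x∈p∧x≢y⇒x∈p-y x∈B x≢f)
      -- `H` is smaller than any basis, so it can be augmented from `B″`; the element added lies in
      -- `C` by definition, hence no basis avoids `C`.
      ¬dual : ¬ IndepDual M C
      ¬dual (B″ , bB″ , C⊆) =
        let e , e∈B″ , e∉H , iHe = indep-aug (indep-⊆ H⊆B (proj₁ bB)) (proj₁ bB″)
              (subst (∣ H ∣ <_) (basis-size bB bB″) (x∈p⇒∣p-x∣<∣p∣ f∈B))
        in x∈∁p⇒x∉p (C⊆ (x∈filter⁺ P? (e∉H , iHe))) e∈B″
      -- Once some `e` is dropped from `C`, the basis `H ∪ ⁅ e ⁆` is disjoint from what remains.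
      minimal : ∀ D → D ⊂ C → IndepDual M D
      minimal D (D⊆C , e , e∈C , e∉D) =
        let e∉H , iHe = x∈filter⁻ P? e∈C in
        H ∪ ⁅ e ⁆ ,
        indep-of-basis-size bB iHe (≡.trans (∣p∪⁅x⁆∣≡1+∣p∣ H e∉H) (1+∣p-x∣≡∣p∣ B f∈B)) ,
        λ {x} x∈D → x∉p⇒x∈∁p λ x∈He → [ proj₁ (x∈filter⁻ P? (D⊆C x∈D)) , (λ { ≡.refl → e∉D x∈D }) ]′
                                       (x∈p∪⁅y⁆⁻ H x∈He)

    dependent⇒∉BC : ∀ {F} → ¬ Indep F → ¬ BCComplex M F
    dependent⇒∉BC ¬iF bc = let C , C⊆F , cC = dependent⇒circuit _ ¬iF in
      bc C cC (C⊆F ∘ removeMin⊆ C)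

    -- c lies in the span of the elements of F that precede it.
    Lexfirst : Subset n → Fin n → Set
    Lexfirst F c = ∃[ D ] (¬ Indep D × (∀ x → x ∈ D → x ≡ c ⊎ (x ∈ F × x Fin.< c)))

    Lexfirst-⊆ : ∀ {F G c} → F ⊆ G → Lexfirst F c → Lexfirst G c
    Lexfirst-⊆ F⊆G (D , ¬iD , D⊆) = D , ¬iD , λ x x∈D →
      [ inj₁ , (λ (x∈F , x<c) → inj₂ (F⊆G x∈F , x<c)) ]′ (D⊆ x x∈D)

    -- The greedy algorithm: the elements are scanned in increasing order and kept whenever
    -- independence survives. The invariant that `F` lies below `k` ensures that a rejected element
    -- is dependent on smaller ones, and `Lexfirst-⊆` preserves this as `F` grows.
    lexfirst-exists : ∃[ F ] (Indep F × (∀ c → c ∉ F → Lexfirst F c))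
    lexfirst-exists = let F , iF , _ , g = go n ℕₚ.≤-refl in F , iF , λ c → g c (Finₚ.toℕ<n c)
      where
      go : ∀ k → k ≤ n → ∃[ F ] (Indep F × (∀ x → x ∈ F → Fin.toℕ x < k) ×
                                 (∀ c → Fin.toℕ c < k → c ∉ F → Lexfirst F c))
      go zero    _ = ⊥ , indep-∅ , (λ x x∈ → contradiction x∈ ∉⊥) , λ c ()
      go (suc k) k<n with go k (ℕₚ.<⇒≤ k<n)
      ... | F , iF , F<k , lex = step (indep? (F ∪ ⁅ e ⁆))
        where
        e = Fin.fromℕ< k<n
        e≡k : Fin.toℕ e ≡ k
        e≡k = Finₚ.toℕ-fromℕ< k<n
        cases : ∀ c → Fin.toℕ c < suc k → Fin.toℕ c < k ⊎ c ≡ e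
        cases c (s≤s c≤k) with ℕₚ.m≤n⇒m<n∨m≡n c≤k
        ... | inj₁ lt = inj₁ lt
        ... | inj₂ eq = inj₂ (Finₚ.toℕ-injective (≡.trans eq (≡.sym e≡k)))
        step : Dec (Indep (F ∪ ⁅ e ⁆)) → _
        step (yes iFe) = F ∪ ⁅ e ⁆ , iFe ,
          (λ x x∈ → [ ℕₚ.m≤n⇒m≤1+n ∘ F<k x , (λ { ≡.refl → s≤s (ℕₚ.≤-reflexive e≡k) }) ]′ (x∈p∪⁅y⁆⁻ F x∈)) ,
          λ c c≤k c∉ → [ (λ c<k → Lexfirst-⊆ (p⊆p∪q _) (lex c c<k (c∉ ∘ p⊆p∪q _)))
                       , (λ { ≡.refl → contradiction (y∈p∪⁅y⁆ e F) c∉ }) ]′ (cases c c≤k)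
        step (no ¬iFe) = F , iF , (λ x → ℕₚ.m≤n⇒m≤1+n ∘ F<k x) ,
          λ c c≤k c∉ → [ (λ c<k → lex c c<k c∉)
                       , (λ { ≡.refl → F ∪ ⁅ e ⁆ , ¬iFe , λ x x∈ →
                            [ (λ x∈F → inj₂ (x∈F , subst (Fin.toℕ x <_) (≡.sym e≡k) (F<k x x∈F))) , inj₁ ]′ (x∈p∪⁅y⁆⁻ F x∈) }) ]′
                       (cases c c≤k)

    -- A smaller `F` could be augmented from `B` by some `e` outside `F`, but the dependent set
    -- witnessing `Lexfirst F e` is contained in `F ∪ ⁅ e ⁆`.
    lexfirst-size : ∀ {B F} → IsBasis M B → Indep F → (∀ c → c ∉ F → Lexfirst F c) → ∣ F ∣ ≡ ∣ B ∣
    lexfirst-size {B} {F} bB iF lex with ∣ F ∣ ℕ.<? ∣ B ∣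
    ... | no ≮ = ℕₚ.≤-antisym (indep-size bB iF) (ℕₚ.≮⇒≥ ≮)
    ... | yes lt =
      let e , _ , e∉F , iFe = indep-aug iF (proj₁ bB) lt
          D , ¬iD , D⊆ = lex e e∉F
      in contradiction (indep-⊆ (λ {x} x∈D → [ (λ { ≡.refl → y∈p∪⁅y⁆ e F }) , p⊆p∪q _ ∘ proj₁ ]′ (D⊆ x x∈D)) iFe) ¬iD

    -- Suppose that the broken circuit of `C` lies in `F`, and let `c` be the minimum of `C`. Then
    -- `c ∉ F`, and exchanging `c` for a larger element `b` of `C` gives an independent set
    -- `(F ∪ ⁅ c ⁆) - b`. It contains the dependent set showing that `c` depends on smaller elements
    -- of `F`, a contradiction.
    lexfirst∈BC : Loopless M → ∀ {F} → Indep F → (∀ c → c ∉ F → Lexfirst F c) → BCComplex M F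
    lexfirst∈BC loopless {F} iF lex C (¬iC , proper) C°⊆F
      with ⊈⇒∃ C F (λ C⊆F → ¬iC (indep-⊆ C⊆F iF))
    ... | c₀ , c₀∈C , _ with removeMin-min C c₀∈C
    ... | c , c∈C , c< , rest with c ∈? F
    ... | yes c∈F = ¬iC (indep-⊆ (λ {x} x∈C → C⊆F x x∈C) iF)
      where
      C⊆F : ∀ x → x ∈ C → x ∈ F
      C⊆F x x∈C with x Fin.≟ c
      ... | yes ≡.refl = c∈F
      ... | no x≢c   = C°⊆F (rest x x∈C x≢c)
    -- Looplessness enters here: `C` is not contained in `⁅ c ⁆`, so it has an element `b` besides
    -- its minimum.
    ... | no c∉F with lex c c∉F | ⊈⇒∃ C ⁅ c ⁆ (λ C⊆c → ¬iC (indep-⊆ C⊆c (loopless c)))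
    ... | D , ¬iD , D⊆ | b , b∈C , b∉c = ¬iD (indep-⊆ D⊆I iI)
      where
      b∈C° = rest b b∈C (x∉⁅y⁆⇒x≢y b∉c)
      Fc = F ∪ ⁅ c ⁆
      C⊆Fc : C ⊆ Fc
      C⊆Fc {x} x∈C with x Fin.≟ c
      ... | yes ≡.refl = y∈p∪⁅y⁆ c F
      ... | no x≢c   = p⊆p∪q _ (C°⊆F (rest x x∈C x≢c))
      iC-b : Indep (C - b)
      iC-b = proper _ (x∈p⇒p-x⊂p b∈C)
      ∣Fc∣ : ∣ Fc ∣ ≡ suc ∣ F ∣
      ∣Fc∣ = ∣p∪⁅x⁆∣≡1+∣p∣ F c∉F
      le : ∣ C - b ∣ ≤ ∣ F ∣
      le = ℕₚ.≤-pred (ℕₚ.≤-trans (ℕₚ.≤-reflexive (1+∣p-x∣≡∣p∣ C b∈C))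
             (ℕₚ.≤-trans (p⊆q⇒∣p∣≤∣q∣ C⊆Fc) (ℕₚ.≤-reflexive ∣Fc∣)))
      ext = extend iC-b iF le
      I = proj₁ ext
      C-b⊆I = proj₁ (proj₂ ext)
      iI = proj₁ (proj₂ (proj₂ (proj₂ ext)))
      b∉I : b ∉ I
      b∉I b∈I = ¬iC (indep-⊆ (λ {x} x∈C → C⊆I x x∈C) iI)
        where
        C⊆I : ∀ x → x ∈ C → x ∈ I
        C⊆I x x∈C with x Fin.≟ b
        ... | yes ≡.refl = b∈I
        ... | no x≢b   = C-b⊆I (x∈p∧x≢y⇒x∈p-y x∈C x≢b)
      I⊆ : I ⊆ Fc - b
      I⊆ {x} x∈I = x∈p∧x≢y⇒x∈p-y
        ([ C⊆Fc ∘ x∈p-y⇒x∈p C , p⊆p∪q _ ]′ (x∈p∪q⁻ (C - b) F (proj₁ (proj₂ (proj₂ ext)) x∈I)))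
        λ { ≡.refl → b∉I x∈I }
      -- Both sets have the size of `F`, so the inclusion `I⊆` is an equality.
      Fc-b⊆I : Fc - b ⊆ I
      Fc-b⊆I = p⊆q∧∣p∣≡∣q∣⇒q⊆p I⊆ (≡.trans (proj₂ (proj₂ (proj₂ (proj₂ ext))))
        (ℕₚ.suc-injective (≡.trans (≡.sym ∣Fc∣) (≡.sym (1+∣p-x∣≡∣p∣ Fc (C⊆Fc b∈C))))))
      -- The elements of `D` are at most `c`, and `c` is below `b`, so `D` avoids `b`.
      D⊆I : D ⊆ I
      D⊆I {x} x∈D with D⊆ x x∈D
      ... | inj₁ ≡.refl = Fc-b⊆I (x∈p∧x≢y⇒x∈p-y (y∈p∪⁅y⁆ c F) λ { ≡.refl → ℕₚ.<-irrefl ≡.refl (c< b b∈C°) })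
      ... | inj₂ (x∈F , x<c) = Fc-b⊆I (x∈p∧x≢y⇒x∈p-y (p⊆p∪q _ x∈F)
                                 λ { ≡.refl → ℕₚ.<-asym x<c (c< b b∈C°) })

-- Decidability of linear independence over the rationals.

∑ℚ-zero : ∀ {n} {f : Fin n → ℚ} → (∀ i → f i ≡ 0ℚ) → ∑ℚ f ≡ 0ℚ
∑ℚ-zero {zero}  eq = ≡.refl
∑ℚ-zero {suc n} eq = cong₂ _+ℚ_ (eq zero) (∑ℚ-zero (eq ∘ suc))

dot : ∀ {n} → (Fin n → ℚ) → (Fin n → ℚ) → ℚ
dot x y = ∑ℚ (λ i → x i *ℚ y i)

dot-comb : ∀ {n} (x y z : Fin n → ℚ) c → dot x (λ i → y i −ℚ c *ℚ z i) ≡ dot x y −ℚ c *ℚ dot x z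
dot-comb {zero}  x y z c = ≡.sym (cong (0ℚ −ℚ_) (ℚₚ.*-zeroʳ c))
dot-comb {suc n} x y z c = ≡.trans (cong (x zero *ℚ (y zero −ℚ c *ℚ z zero) +ℚ_)
    (dot-comb (x ∘ suc) (y ∘ suc) (z ∘ suc) c))
  (solve 6 (λ a b c d s t → a :* (b :+ :- (c :* d)) :+ (s :+ :- (c :* t)) :=
                            (a :* b :+ s) :+ :- (c :* (a :* d :+ t))) ≡.refl
     (x zero) (y zero) c (z zero) (dot (x ∘ suc) (y ∘ suc)) (dot (x ∘ suc) (z ∘ suc)))
  where open +-*-Solver

indicator : ∀ {n} → Fin n → Fin n → ℚ
indicator i j = if does (i Fin.≟ j) then 1ℚ else 0ℚ

dot-indicator : ∀ {n} (x : Fin n → ℚ) i → dot x (indicator i) ≡ x i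
dot-indicator x zero    = ≡.trans
  (cong₂ _+ℚ_ (ℚₚ.*-identityʳ (x zero)) (∑ℚ-zero λ i → ℚₚ.*-zeroʳ (x (suc i))))
  (ℚₚ.+-identityʳ (x zero))
dot-indicator x (suc i) = ≡.trans
  (cong₂ _+ℚ_ (ℚₚ.*-zeroʳ (x zero)) (dot-indicator (x ∘ suc) i))
  (ℚₚ.+-identityˡ (x (suc i)))

-- Both alternatives are stated positively, since the elimination step lifts an explicit kernel
-- vector.
TrivialKernel NonzeroKernel : ∀ {q n} → (Fin q → Fin n → ℚ) → Set
TrivialKernel L = ∀ x → (∀ a → dot x (L a) ≡ 0ℚ) → ∀ i → x i ≡ 0ℚ
NonzeroKernel L = ∃[ x ] ((∀ a → dot x (L a) ≡ 0ℚ) × ∃[ i ] x i ≢ 0ℚ)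

-- Gaussian elimination by induction on the number of columns. Kernel vectors of the reduced matrix
-- `L′` are exactly the tails of kernel vectors of `L`, the first coordinate being determined by the
-- pivot row.
kernel? : ∀ {q} n (L : Fin q → Fin n → ℚ) → TrivialKernel L ⊎ NonzeroKernel L
kernel? zero L = inj₁ λ x _ ()
kernel? {q} (suc n) L with Finₚ.any? (λ a → ¬? (L a zero ℚₚ.≟ 0ℚ))
-- A vanishing first column puts the first unit vector into the kernel.
... | no none = inj₂ (indicator zero , (λ a → cong₂ _+ℚ_
        (≡.trans (ℚₚ.*-identityˡ _) (decidable-stable (L a zero ℚₚ.≟ 0ℚ) λ ≢0 → none (a , ≢0)))
        (∑ℚ-zero λ i → ℚₚ.*-zeroˡ (L a (suc i)))) , zero , λ ())
... | yes (a₀ , p≢0) = pivot (kernel? n L′)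
  where
  open +-*-Solver
  p = L a₀ zero
  instance
    _ : NonZero p
    _ = ≢-nonZero p≢0
  p⁻¹ = 1/ p
  L′ : Fin q → Fin n → ℚ
  -- The pivot row itself turns into a zero row, a void condition, so the rows need no reindexing.
  L′ a i = L a (suc i) −ℚ (L a zero *ℚ p⁻¹) *ℚ L a₀ (suc i)

  regroup : ∀ s l t → s −ℚ (l *ℚ p⁻¹) *ℚ t ≡ (-ℚ (p⁻¹ *ℚ t)) *ℚ l +ℚ s
  regroup s l t =
    solve 4 (λ s l q t → s :+ :- ((l :* q) :* t) := (:- (q :* t)) :* l :+ s) ≡.refl s l p⁻¹ t

  pivot : TrivialKernel L′ ⊎ NonzeroKernel L′ → TrivialKernel L ⊎ NonzeroKernel L
  pivot (inj₁ trivial) = inj₁ injective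
    where
    injective : ∀ x → (∀ a → dot x (L a) ≡ 0ℚ) → ∀ i → x i ≡ 0ℚ
    injective x Lx = λ { zero → x₀≡0 ; (suc i) → y≡0 i }
      where
      open ≡.≡-Reasoning
      y = x ∘ suc
      S : Fin q → ℚ
      S a = dot y (L a ∘ suc)
      x₀ : x zero ≡ -ℚ (p⁻¹ *ℚ S a₀)
      x₀ = begin
        x zero                                  ≡⟨ ℚₚ.*-identityʳ (x zero) ⟨
        x zero *ℚ 1ℚ                            ≡⟨ cong (x zero *ℚ_) (ℚₚ.*-inverseʳ p) ⟨
        x zero *ℚ (p *ℚ p⁻¹)
          ≡⟨ solve 4 (λ x p q s → x :* (p :* q) := q :* (x :* p :+ s) :+ :- (q :* s)) ≡.refl
               (x zero) p p⁻¹ (S a₀) ⟩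
        p⁻¹ *ℚ (x zero *ℚ p +ℚ S a₀) −ℚ p⁻¹ *ℚ S a₀ ≡⟨ cong (λ t → p⁻¹ *ℚ t −ℚ p⁻¹ *ℚ S a₀) (Lx a₀) ⟩
        p⁻¹ *ℚ 0ℚ −ℚ p⁻¹ *ℚ S a₀                ≡⟨ cong (_−ℚ p⁻¹ *ℚ S a₀) (ℚₚ.*-zeroʳ p⁻¹) ⟩
        0ℚ −ℚ p⁻¹ *ℚ S a₀                       ≡⟨ ℚₚ.+-identityˡ _ ⟩
        -ℚ (p⁻¹ *ℚ S a₀)                        ∎
      y≡0 : ∀ i → y i ≡ 0ℚ
      y≡0 = trivial y λ a → begin
        dot y (L′ a)                            ≡⟨ dot-comb y _ _ (L a zero *ℚ p⁻¹) ⟩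
        S a −ℚ (L a zero *ℚ p⁻¹) *ℚ S a₀        ≡⟨ regroup (S a) (L a zero) (S a₀) ⟩
        (-ℚ (p⁻¹ *ℚ S a₀)) *ℚ L a zero +ℚ S a   ≡⟨ cong (λ t → t *ℚ L a zero +ℚ S a) x₀ ⟨
        dot x (L a)                             ≡⟨ Lx a ⟩
        0ℚ                                      ∎
      x₀≡0 : x zero ≡ 0ℚ
      x₀≡0 = ≡.trans x₀ (cong -ℚ_ (≡.trans (cong (p⁻¹ *ℚ_)
               (∑ℚ-zero λ i → ≡.trans (cong (_*ℚ L a₀ (suc i)) (y≡0 i)) (ℚₚ.*-zeroˡ (L a₀ (suc i)))))
               (ℚₚ.*-zeroʳ p⁻¹)))
  pivot (inj₂ (y , L′y , i , yi≢0)) = inj₂ (x , Lx , suc i , yi≢0)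
    where
    open ≡.≡-Reasoning
    S : Fin q → ℚ
    S a = dot y (L a ∘ suc)
    x : Fin (suc n) → ℚ
    -- The solution of the pivot equation for the first coordinate.
    x zero    = -ℚ (p⁻¹ *ℚ S a₀)
    x (suc i) = y i
    Lx : ∀ a → dot x (L a) ≡ 0ℚ
    Lx a = begin
      (-ℚ (p⁻¹ *ℚ S a₀)) *ℚ L a zero +ℚ S a   ≡⟨ regroup (S a) (L a zero) (S a₀) ⟨
      S a −ℚ (L a zero *ℚ p⁻¹) *ℚ S a₀        ≡⟨ dot-comb y _ _ (L a zero *ℚ p⁻¹) ⟨
      dot y (L′ a)                            ≡⟨ L′y a ⟩
      0ℚ                                      ∎

-- The condition that `x` vanishes off `X` is itself linear. Appending it to `A` as the rows `offX`
-- turns independence of the columns in `X` into triviality of the kernel of `L`.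
columnsIndependent? : ∀ {p n} (A : Fin p → Fin n → ℚ) X → Dec (ColumnsIndependent A X)
columnsIndependent? {p} {n} A X = decide (kernel? n L)
  where
  offX : Fin n → Fin n → ℚ
  offX i with i ∈? X
  ... | yes _ = λ _ → 0ℚ
  ... | no  _ = indicator i
  L : Fin (p +ℕ n) → Fin n → ℚ
  L a = [ A , offX ]′ (splitAt p a)

  offX-∈ : ∀ x → (∀ i → i ∉ X → x i ≡ 0ℚ) → ∀ i → dot x (offX i) ≡ 0ℚ
  offX-∈ x x∉ i with i ∈? X
  ... | yes _   = ∑ℚ-zero λ j → ℚₚ.*-zeroʳ (x j)
  ... | no  i∉X = ≡.trans (dot-indicator x i) (x∉ i i∉X)
  offX-∉ : ∀ x i → dot x (offX i) ≡ 0ℚ → i ∉ X → x i ≡ 0ℚ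
  offX-∉ x i eq i∉X with i ∈? X
  ... | yes i∈X = contradiction i∈X i∉X
  ... | no  _   = ≡.trans (≡.sym (dot-indicator x i)) eq

  decide : TrivialKernel L ⊎ NonzeroKernel L → Dec (ColumnsIndependent A X)
  decide (inj₁ trivial) = yes λ x x∉ Ax → trivial x λ a → Lx x x∉ Ax (splitAt p a)
    where
    Lx : ∀ x → (∀ i → i ∉ X → x i ≡ 0ℚ) → (∀ a → dot x (A a) ≡ 0ℚ) →
         ∀ s → dot x ([ A , offX ]′ s) ≡ 0ℚ
    Lx x x∉ Ax (inj₁ a) = Ax a
    Lx x x∉ Ax (inj₂ i) = offX-∈ x x∉ i
  decide (inj₂ (x , Lx , i , xi≢0)) = no λ ind → xi≢0 (ind x
    (λ j → offX-∉ x j (≡.trans (cong (λ s → dot x ([ A , offX ]′ s)) (≡.sym (Finₚ.splitAt-↑ʳ p n j))) (Lx (p ↑ʳ j))))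
    (λ a → ≡.trans (cong (λ s → dot x ([ A , offX ]′ s)) (≡.sym (Finₚ.splitAt-↑ˡ p a n))) (Lx (a ↑ˡ n))) i)

regular⇒indep? : ∀ {n} (M : Matroid n) → Regular M → ∀ X → Dec (Matroid.Indep M X)
regular⇒indep? M (p , A , _ , ↔) X with columnsIndependent? A X
... | yes i = yes (proj₂ (↔ X) i)
... | no ¬i = no (¬i ∘ proj₁ (↔ X))

-- Finite sums, exponent vectors and their supports.

module _ {a ℓ} (M : CommutativeMonoid a ℓ) where
  open CommutativeMonoid M
  open import Algebra.Properties.CommutativeMonoid.Sum M

  sum-zero : ∀ {n} {f : Fin n → Carrier} → (∀ i → f i ≈ ε) → sum f ≈ ε
  sum-zero {n} f≈0 = trans (sum-cong-≋ f≈0) (sum-replicate-zero n)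

  sum-single : ∀ {n} {f : Fin n → Carrier} k → (∀ i → i ≢ k → f i ≈ ε) → sum f ≈ f k
  sum-single {suc n} {f} k f≈0 = trans (sum-remove {i = k} f)
    (trans (∙-congˡ (sum-zero λ j → f≈0 _ (Finₚ.punchInᵢ≢i k j))) (identityʳ _))

-- Turns multiplication by a variable into `updateAt β i suc`, the form in which degree and support
-- are tracked.
unitExp-+ : ∀ {c ℓ} (K : Field c ℓ) {n} (i : Fin n) (β : Vec ℕ n) →
            zipWith _+ℕ_ (OverField.unitExp K i) β ≡ updateAt β i suc
unitExp-+ K zero (b ∷ β) = cong (suc b ∷_) (zeros β)
  where
  zeros : ∀ {n} (β : Vec ℕ n) → zipWith _+ℕ_ (tabulate λ _ → 0) β ≡ β
  zeros []      = ≡.refl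
  zeros (b ∷ β) = cong (b ∷_) (zeros β)
unitExp-+ K (suc i) (b ∷ β) = cong (b ∷_) (≡.trans
  (cong (λ v → zipWith _+ℕ_ v β)
    (tabulate-cong λ j → cong (λ t → if t then 1 else 0) (⌊⌋-map′ _ _ (i Fin.≟ j))))
  (unitExp-+ K i β))

positive : ℕ → Bool
positive zero    = false
positive (suc _) = true

supp : ∀ {n} → Vec ℕ n → Subset n
supp = Vec.map positive

∈supp : ∀ {n} (α : Vec ℕ n) {i k} → suc k ≤ lookup α i → i ∈ supp α
∈supp (suc a ∷ α) {zero}  lt = here
∈supp (a ∷ α)     {suc i} lt = there (∈supp α lt)

supp-suc : ∀ {n} (β : Vec ℕ n) i → supp (updateAt β i suc) ≡ supp β ∪ ⁅ i ⁆
supp-suc (zero  ∷ β) zero    = cong (true ∷_) (≡.sym (∪-identityʳ (supp β)))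
supp-suc (suc b ∷ β) zero    = cong (true ∷_) (≡.sym (∪-identityʳ (supp β)))
supp-suc (zero  ∷ β) (suc i) = cong (false ∷_) (supp-suc β i)
supp-suc (suc b ∷ β) (suc i) = cong (true ∷_) (supp-suc β i)

sum-suc : ∀ {n} (β : Vec ℕ n) i → Vec.sum (updateAt β i suc) ≡ suc (Vec.sum β)
sum-suc (b ∷ β) zero    = ≡.refl
sum-suc (b ∷ β) (suc i) = ≡.trans (cong (b +ℕ_) (sum-suc β i)) (ℕₚ.+-suc b _)

-- An exponent that is at least 2 stays positive when lowered by one, so a factor can be split off
-- without changing the support.
lower-exponent : ∀ {n} (α : Vec ℕ n) f → 2 ≤ lookup α f →
                 ∃[ β ] (α ≡ updateAt β f suc × supp β ≡ supp α)
lower-exponent (suc zero ∷ α) zero (s≤s ())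
lower-exponent (suc (suc a) ∷ α) zero _ = suc a ∷ α , ≡.refl , ≡.refl
lower-exponent (a ∷ α) (suc f) le =
  let β , eq , seq = lower-exponent α f le in a ∷ β , cong (a ∷_) eq , cong (positive a ∷_) seq

bit : Bool → ℕ
bit b = if b then 1 else 0

squarefree : ∀ {n} (α : Vec ℕ n) → (∀ i → ¬ (2 ≤ lookup α i)) → α ≡ Vec.map bit (supp α)
squarefree []                _  = ≡.refl
squarefree (zero ∷ α)        le = cong (0 ∷_) (squarefree α (le ∘ suc))
squarefree (suc zero ∷ α)    le = cong (1 ∷_) (squarefree α (le ∘ suc))
squarefree (suc (suc a) ∷ α) le = contradiction (s≤s (s≤s z≤n)) (le zero)

-- Splits off the squarefree monomial of the support, which shows that a monomial supported on a
-- nonface lies in the ideal.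
divide-supp : ∀ {n} (α : Vec ℕ n) → zipWith _+ℕ_ (Vec.map ℕ.pred α) (Vec.map bit (supp α)) ≡ α
divide-supp []          = ≡.refl
divide-supp (zero  ∷ α) = cong (0 ∷_) (divide-supp α)
divide-supp (suc a ∷ α) = cong₂ _∷_ (ℕₚ.+-comm a 1) (divide-supp α)

subsets : ∀ n → List (Subset n)
subsets zero    = [] ∷ []
subsets (suc n) = List.map (true ∷_) (subsets n) ++ List.map (false ∷_) (subsets n)

∈subsets : ∀ {n} (F : Subset n) → F Membership.∈ subsets n
∈subsets []          = Any.here ≡.refl
∈subsets (true  ∷ F) = ∈-++⁺ˡ (∈-map⁺ _ (∈subsets F))
∈subsets (false ∷ F) = ∈-++⁺ʳ _ (∈-map⁺ _ (∈subsets F))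

-- The polynomial ring and linear functionals on it.

module _ {c ℓ} (K : Field c ℓ) where
  open Field K hiding (zero)
  open OverField K
  open SetoidReasoning setoid
  open import Algebra.Properties.Ring ring using (-0#≈0#; -‿distribˡ-*; -‿+-comm)
  open import Algebra.Properties.CommutativeSemigroup
    (CommutativeRing.*-commutativeSemigroup commutativeRing) using (x∙yz≈y∙xz)
  open import Algebra.Properties.CommutativeSemigroup
    (CommutativeMonoid.commutativeSemigroup +-commutativeMonoid) using () renaming (interchange to +-interchange)
  open import Algebra.Properties.Semiring.Sum semiring
    using (sum; sum-cong-≋; ∑-distrib-+; ∑-comm; *-distribˡ-sum; *-distribʳ-sum)

  ∑≡sum : ∀ {n} (f : Fin n → Carrier) → ∑ f ≡ sum f
  ∑≡sum {zero}  f = ≡.refl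
  ∑≡sum {suc n} f = cong (f zero +_) (∑≡sum (f ∘ suc))

  ∑≈sum : ∀ {n} (f : Fin n → Carrier) → ∑ f ≈ sum f
  ∑≈sum f = reflexive (∑≡sum f)

  ∑-cong : ∀ {n} {f g : Fin n → Carrier} → (∀ i → f i ≈ g i) → ∑ f ≈ ∑ g
  ∑-cong {f = f} {g} f≈g = trans (∑≈sum f) (trans (sum-cong-≋ f≈g) (sym (∑≈sum g)))

  ∑-zero : ∀ {n} {f : Fin n → Carrier} → (∀ i → f i ≈ 0#) → ∑ f ≈ 0#
  ∑-zero {f = f} f≈0 = trans (∑≈sum f) (sum-zero +-commutativeMonoid f≈0)

  ∑-single : ∀ {n} {f : Fin n → Carrier} k → (∀ i → i ≢ k → f i ≈ 0#) → ∑ f ≈ f k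
  ∑-single {f = f} k f≈0 = trans (∑≈sum f) (sum-single +-commutativeMonoid k f≈0)

  ∑-+ : ∀ {n} (f g : Fin n → Carrier) → ∑ (λ i → f i + g i) ≈ ∑ f + ∑ g
  ∑-+ f g = trans (∑≈sum (λ i → f i + g i)) (trans (∑-distrib-+ f g) (sym (+-cong (∑≈sum f) (∑≈sum g))))

  *-∑ : ∀ {n} x (f : Fin n → Carrier) → x * ∑ f ≈ ∑ (λ i → x * f i)
  *-∑ x f = trans (*-congˡ (∑≈sum f)) (trans (*-distribˡ-sum x f) (sym (∑≈sum (λ i → x * f i))))

  ∑-* : ∀ {n} (f : Fin n → Carrier) x → ∑ f * x ≈ ∑ (λ i → f i * x)
  ∑-* f x = trans (*-congʳ (∑≈sum f)) (trans (*-distribʳ-sum x f) (sym (∑≈sum (λ i → f i * x))))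

  ∑-swap : ∀ {m n} (f : Fin m → Fin n → Carrier) → ∑ (λ i → ∑ (f i)) ≈ ∑ (λ j → ∑ (λ i → f i j))
  ∑-swap f = begin
    ∑ (λ i → ∑ (f i))               ≈⟨ ∑-cong (λ i → ∑≈sum (f i)) ⟩
    ∑ (λ i → sum (f i))             ≈⟨ ∑≈sum (λ i → sum (f i)) ⟩
    sum (λ i → sum (f i))           ≈⟨ ∑-comm f ⟩
    sum (λ j → sum (λ i → f i j))   ≈⟨ ∑≈sum (λ j → sum (λ i → f i j)) ⟨
    ∑ (λ j → sum (λ i → f i j))     ≈⟨ ∑-cong (λ j → ∑≈sum (λ i → f i j)) ⟨
    ∑ (λ j → ∑ (λ i → f i j))       ∎

  -- The linear functional with values `φ` on the monomials, evaluated at a polynomial.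
  pair : ∀ {n} → Poly n → (Vec ℕ n → Carrier) → Carrier
  pair []            φ = 0#
  pair ((a , α) ∷ p) φ = a * φ α + pair p φ

  -- Equality under all linear functionals implies ≈ₚ (take the coefficient
  -- functionals) and, unlike ≈ₚ, is a congruence for *ₚ by mere unfolding.
  infix 4 _∼_
  record _∼_ {n} (p q : Poly n) : Set (c ⊔ ℓ) where
    constructor ∼-intro
    field at : ∀ φ → pair p φ ≈ pair q φ
  open _∼_

  coeff≈pair : ∀ {n} (p : Poly n) α →
               coeff p α ≈ pair p (λ β → if ⌊ ≡-dec _≟ℕ_ β α ⌋ then 1# else 0#)
  coeff≈pair []            α = refl
  coeff≈pair ((a , β) ∷ p) α = +-cong (if-* ⌊ ≡-dec _≟ℕ_ β α ⌋) (coeff≈pair p α)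
    where
    if-* : ∀ b → (if b then a else 0#) ≈ a * (if b then 1# else 0#)
    if-* true  = sym (*-identityʳ a)
    if-* false = sym (zeroʳ a)

  ∼⇒≈ₚ : ∀ {n} {p q : Poly n} → p ∼ q → p ≈ₚ q
  ∼⇒≈ₚ {p = p} {q} p∼q α = trans (coeff≈pair p α) (trans (at p∼q _) (sym (coeff≈pair q α)))

  pair-cong : ∀ {n} (p : Poly n) {φ ψ} → (∀ α → φ α ≈ ψ α) → pair p φ ≈ pair p ψ
  pair-cong []            φ≈ψ = refl
  pair-cong ((a , α) ∷ p) φ≈ψ = +-cong (*-congˡ (φ≈ψ α)) (pair-cong p φ≈ψ)

  pair-0 : ∀ {n} (p : Poly n) → pair p (λ _ → 0#) ≈ 0#
  pair-0 []            = refl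
  pair-0 ((a , α) ∷ p) = trans (+-cong (zeroʳ a) (pair-0 p)) (+-identityˡ 0#)

  pair-+ : ∀ {n} (p : Poly n) φ ψ → pair p (λ α → φ α + ψ α) ≈ pair p φ + pair p ψ
  pair-+ []            φ ψ = sym (+-identityˡ 0#)
  pair-+ ((a , α) ∷ p) φ ψ = trans (+-cong (distribˡ a _ _) (pair-+ p φ ψ)) (+-interchange _ _ _ _)

  pair-* : ∀ {n} (p : Poly n) x φ → pair p (λ α → x * φ α) ≈ x * pair p φ
  pair-* []            x φ = sym (zeroʳ x)
  pair-* ((a , α) ∷ p) x φ = trans (+-cong (x∙yz≈y∙xz a x _) (pair-* p x φ)) (sym (distribˡ x _ _))

  pair-++ : ∀ {n} (p q : Poly n) φ → pair (p +ₚ q) φ ≈ pair p φ + pair q φ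
  pair-++ []      q φ = sym (+-identityˡ _)
  pair-++ (t ∷ p) q φ = trans (+-congˡ (pair-++ p q φ)) (sym (+-assoc _ _ _))

  pair-neg : ∀ {n} (p : Poly n) φ → pair (-ₚ p) φ ≈ - pair p φ
  pair-neg []            φ = sym -0#≈0#
  pair-neg ((a , α) ∷ p) φ = trans (+-cong (sym (-‿distribˡ-* a _)) (pair-neg p φ)) (-‿+-comm _ _)

  -- Reduces the ring laws for `*ₚ` to the laws for addition of exponents and to rearrangement of
  -- iterated sums.
  pair-*ₚ : ∀ {n} (p q : Poly n) φ → pair (p *ₚ q) φ ≈ pair p (λ α → pair q (λ β → φ (zipWith _+ℕ_ α β)))
  pair-*ₚ []            q φ = refl
  pair-*ₚ ((a , α) ∷ p) q φ = trans (pair-++ (List.map _ q) (p *ₚ q) φ) (+-cong (shift q) (pair-*ₚ p q φ))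
    where
    shift : ∀ q → pair (List.map (λ { (b , β) → a * b , zipWith _+ℕ_ α β }) q) φ
                  ≈ a * pair q (λ β → φ (zipWith _+ℕ_ α β))
    shift []            = sym (zeroʳ a)
    shift ((b , β) ∷ q) = trans (+-cong (*-assoc a b _) (shift q)) (sym (distribˡ a _ _))

  -- Interchange of two finite sums, the source of commutativity of `*ₚ`.
  pair-swap : ∀ {n m} (p : Poly n) (q : Poly m) (ψ : Vec ℕ n → Vec ℕ m → Carrier) →
              pair p (λ α → pair q (ψ α)) ≈ pair q (λ β → pair p (λ α → ψ α β))
  pair-swap []            q ψ = sym (pair-0 q)
  pair-swap ((a , α) ∷ p) q ψ = trans
    (+-cong (sym (pair-* q a (ψ α))) (pair-swap p q ψ))
    (sym (pair-+ q (λ β → a * ψ α β) (λ β → pair p (λ α → ψ α β))))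

  polyRing : ℕ → CommutativeRing c (c ⊔ ℓ)
  polyRing n = record
    { Carrier = Poly n ; _≈_ = _∼_ ; _+_ = _+ₚ_ ; _*_ = _*ₚ_ ; -_ = -ₚ_ ; 0# = 0ₚ ; 1# = 1ₚ
    ; isCommutativeRing = record
      { isRing = record
        { +-isAbelianGroup = record
          { isGroup = record
            { isMonoid = record
              { isSemigroup = record
                { isMagma = record
                  { isEquivalence = record
                    { refl  = ∼-intro λ φ → refl
                    ; sym   = λ p∼q → ∼-intro λ φ → sym (at p∼q φ)
                    ; trans = λ p∼q q∼r → ∼-intro λ φ → trans (at p∼q φ) (at q∼r φ)
                    }
                  ; ∙-cong = λ {p} {p′} {q} {q′} p∼p′ q∼q′ → ∼-intro λ φ →
                      trans (pair-++ p q φ) (trans (+-cong (at p∼p′ φ) (at q∼q′ φ)) (sym (pair-++ p′ q′ φ)))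
                  }
                ; assoc = λ p q r → ∼-intro λ φ → trans (pair-++ (p ++ q) r φ) (trans (+-congʳ (pair-++ p q φ))
                    (trans (+-assoc _ _ _) (sym (trans (pair-++ p (q ++ r) φ) (+-congˡ (pair-++ q r φ))))))
                }
              ; identity = (λ p → ∼-intro λ φ → refl) , (λ p → ∼-intro λ φ → trans (pair-++ p [] φ) (+-identityʳ _))
              }
            ; inverse = (λ p → ∼-intro λ φ → trans (pair-++ (-ₚ p) p φ) (trans (+-congʳ (pair-neg p φ)) (-‿inverseˡ _)))
                      , (λ p → ∼-intro λ φ → trans (pair-++ p (-ₚ p) φ) (trans (+-congˡ (pair-neg p φ)) (-‿inverseʳ _)))
            ; ⁻¹-cong = λ {p} {q} p∼q → ∼-intro λ φ → trans (pair-neg p φ) (trans (-‿cong (at p∼q φ)) (sym (pair-neg q φ)))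
            }
          ; comm = comm
          }
        ; *-cong = λ {p} {p′} {q} {q′} p∼p′ q∼q′ → ∼-intro λ φ → trans (pair-*ₚ p q φ)
            (trans (at p∼p′ _) (trans (pair-cong p′ (λ α → at q∼q′ _)) (sym (pair-*ₚ p′ q′ φ))))
        ; *-assoc = *ₚ-assoc
        ; *-identity = *ₚ-identityˡ , λ p → ∼-intro λ φ → trans (at (*ₚ-comm p 1ₚ) φ) (at (*ₚ-identityˡ p) φ)
        ; distrib = (λ p q r → ∼-intro λ φ → trans (at (*ₚ-comm p (q ++ r)) φ) (trans (at (*ₚ-distribʳ p q r) φ)
                      (trans (pair-++ (q *ₚ p) (r *ₚ p) φ) (trans (+-cong (at (*ₚ-comm q p) φ) (at (*ₚ-comm r p) φ))
                        (sym (pair-++ (p *ₚ q) (p *ₚ r) φ))))))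
                  , *ₚ-distribʳ
        }
      ; *-comm = *ₚ-comm
      }
    }
    where
    comm : ∀ (p q : Poly n) → p +ₚ q ∼ q +ₚ p
    comm p q = ∼-intro λ φ → trans (pair-++ p q φ) (trans (+-comm _ _) (sym (pair-++ q p φ)))

    *ₚ-assoc : ∀ (p q r : Poly n) → (p *ₚ q) *ₚ r ∼ p *ₚ (q *ₚ r)
    *ₚ-assoc p q r = ∼-intro λ φ → begin
      pair ((p *ₚ q) *ₚ r) φ
        ≈⟨ pair-*ₚ (p *ₚ q) r φ ⟩
      pair (p *ₚ q) (λ δ → pair r (λ γ → φ (zipWith _+ℕ_ δ γ)))
        ≈⟨ pair-*ₚ p q _ ⟩
      pair p (λ α → pair q (λ β → pair r (λ γ → φ (zipWith _+ℕ_ (zipWith _+ℕ_ α β) γ))))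
        ≈⟨ pair-cong p (λ α → pair-cong q λ β → pair-cong r λ γ →
             reflexive (cong φ (zipWith-assoc ℕₚ.+-assoc α β γ))) ⟩
      pair p (λ α → pair q (λ β → pair r (λ γ → φ (zipWith _+ℕ_ α (zipWith _+ℕ_ β γ)))))
        ≈⟨ pair-cong p (λ α → pair-*ₚ q r _) ⟨
      pair p (λ α → pair (q *ₚ r) (λ δ → φ (zipWith _+ℕ_ α δ)))
        ≈⟨ pair-*ₚ p (q *ₚ r) φ ⟨
      pair (p *ₚ (q *ₚ r)) φ ∎

    *ₚ-comm : ∀ (p q : Poly n) → p *ₚ q ∼ q *ₚ p
    *ₚ-comm p q = ∼-intro λ φ → begin
      pair (p *ₚ q) φ                                     ≈⟨ pair-*ₚ p q φ ⟩
      pair p (λ α → pair q (λ β → φ (zipWith _+ℕ_ α β)))  ≈⟨ pair-swap p q _ ⟩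
      pair q (λ β → pair p (λ α → φ (zipWith _+ℕ_ α β)))
        ≈⟨ pair-cong q (λ β → pair-cong p λ α → reflexive (cong φ (zipWith-comm ℕₚ.+-comm α β))) ⟩
      pair q (λ β → pair p (λ α → φ (zipWith _+ℕ_ β α)))  ≈⟨ pair-*ₚ q p φ ⟨
      pair (q *ₚ p) φ                                     ∎

    *ₚ-identityˡ : ∀ (p : Poly n) → 1ₚ *ₚ p ∼ p
    *ₚ-identityˡ p = ∼-intro λ φ → begin
      pair (1ₚ *ₚ p) φ                                             ≈⟨ pair-*ₚ 1ₚ p φ ⟩
      1# * pair p (λ β → φ (zipWith _+ℕ_ (replicate n 0) β)) + 0#  ≈⟨ +-identityʳ _ ⟩
      1# * pair p (λ β → φ (zipWith _+ℕ_ (replicate n 0) β))       ≈⟨ *-identityˡ _ ⟩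
      pair p (λ β → φ (zipWith _+ℕ_ (replicate n 0) β))
        ≈⟨ pair-cong p (λ β → reflexive (cong φ (zipWith-identityˡ ℕₚ.+-identityˡ β))) ⟩
      pair p φ                                                     ∎

    *ₚ-distribʳ : ∀ (p q r : Poly n) → (q +ₚ r) *ₚ p ∼ (q *ₚ p) +ₚ (r *ₚ p)
    *ₚ-distribʳ p q r = ∼-intro λ φ → begin
      pair ((q ++ r) *ₚ p) φ                      ≈⟨ pair-*ₚ (q ++ r) p φ ⟩
      pair (q ++ r) _                             ≈⟨ pair-++ q r _ ⟩
      pair q _ + pair r _                         ≈⟨ +-cong (pair-*ₚ q p φ) (pair-*ₚ r p φ) ⟨
      pair (q *ₚ p) φ + pair (r *ₚ p) φ           ≈⟨ pair-++ (q *ₚ p) (r *ₚ p) φ ⟨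
      pair ((q *ₚ p) +ₚ (r *ₚ p)) φ               ∎

  const : ∀ {n} → Carrier → Poly n
  const a = (a , replicate _ 0) ∷ []

  mono : ∀ {n} → Vec ℕ n → Poly n
  mono α = (1# , α) ∷ []

  pair-mono : ∀ {n} (α : Vec ℕ n) φ → pair (mono α) φ ≈ φ α
  pair-mono α φ = trans (+-identityʳ _) (*-identityˡ _)

  pair-const : ∀ {n} x (p : Poly n) φ → pair (const x *ₚ p) φ ≈ x * pair p φ
  pair-const x p φ = trans (pair-*ₚ (const x) p φ) (trans (+-identityʳ _)
    (*-congˡ (pair-cong p λ β → reflexive (cong φ (zipWith-identityˡ ℕₚ.+-identityˡ β)))))

  pair-∑ₚ : ∀ {n m} (f : Fin m → Poly n) φ → pair (∑ₚ f) φ ≈ ∑ (λ i → pair (f i) φ)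
  pair-∑ₚ {m = zero}  f φ = refl
  pair-∑ₚ {m = suc m} f φ = trans (pair-++ (f zero) _ φ) (+-congˡ (pair-∑ₚ (f ∘ suc) φ))

  pair-linForm-mono : ∀ {n} (a : Fin n → Carrier) β φ →
                      pair (linForm a *ₚ mono β) φ ≈ ∑ (λ i → a i * φ (updateAt β i suc))
  pair-linForm-mono a β φ = trans (pair-*ₚ (linForm a) (mono β) φ)
    (trans (pair-∑ₚ (λ i → (a i , unitExp i) ∷ []) (λ α → pair (mono β) (φ ∘ zipWith _+ℕ_ α))) (∑-cong λ i →
      trans (+-identityʳ _) (*-congˡ (trans (pair-mono β (φ ∘ zipWith _+ℕ_ (unitExp i))) (reflexive (cong φ (unitExp-+ K i β)))))))

  const-* : ∀ {n} x y → const {n} (x * y) ∼ const x *ₚ const y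
  const-* {n} x y = ∼-intro λ φ → sym (trans (pair-const x (const y) φ)
    (trans (*-congˡ (+-identityʳ _)) (trans (sym (*-assoc x y _)) (sym (+-identityʳ _)))))

  module _ {n : ℕ} where
    private module P = CommutativeRing (polyRing n)
    open import Algebra.Properties.CommutativeSemigroup P.*-commutativeSemigroup
      using () renaming (x∙yz≈y∙xz to x*yz∼y*xz)
    open import Algebra.Properties.CommutativeSemigroup
      (CommutativeMonoid.commutativeSemigroup P.+-commutativeMonoid) using () renaming (interchange to +ₚ-interchange)
    open import Algebra.Properties.Semiring.Sum P.semiring using () renaming
      (sum to sumₚ; sum-cong-≋ to sumₚ-cong-≋; ∑-distrib-+ to ∑ₚ-distrib-+; *-distribˡ-sum to *ₚ-distribˡ-sum)

    monoSubst-0 : ∀ {d} (θ : Fin d → Poly n) → monoSubst (replicate d 0) θ ∼ 1ₚ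
    monoSubst-0 {zero}  θ = P.refl
    monoSubst-0 {suc d} θ = P.trans (P.*-identityˡ (monoSubst (replicate d 0) (θ ∘ suc))) (monoSubst-0 (θ ∘ suc))

    monoSubst-suc : ∀ {d} (θ : Fin d → Poly n) α j →
                    monoSubst (updateAt α j suc) θ ∼ θ j *ₚ monoSubst α θ
    monoSubst-suc θ (a ∷ α) zero    = P.*-assoc (θ zero) (θ zero ^ₚ a) (monoSubst α (θ ∘ suc))
    monoSubst-suc θ (a ∷ α) (suc j) =
      P.trans (P.*-congˡ {θ zero ^ₚ a} (monoSubst-suc (θ ∘ suc) α j)) (x*yz∼y*xz (θ zero ^ₚ a) (θ (suc j)) (monoSubst α (θ ∘ suc)))

    module _ {d} (θ : Fin d → Poly n) where
      evalAt-1 : evalAt 1ₚ θ ∼ 1ₚ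
      evalAt-1 = P.trans (P.+-identityʳ (1ₚ *ₚ monoSubst (replicate d 0) θ))
        (P.trans (P.*-identityˡ (monoSubst (replicate d 0) θ)) (monoSubst-0 θ))

      evalAt-++ : ∀ p q → evalAt (p +ₚ q) θ ∼ evalAt p θ +ₚ evalAt q θ
      evalAt-++ []            q = P.refl
      evalAt-++ ((a , α) ∷ p) q = P.trans (P.+-congˡ {const a *ₚ monoSubst α θ} (evalAt-++ p q))
        (P.sym (P.+-assoc (const a *ₚ monoSubst α θ) (evalAt p θ) (evalAt q θ)))

      scale : Carrier → Poly d → Poly d
      scale x = List.map (λ (a , α) → x * a , α)

      evalAt-scale : ∀ x p → evalAt (scale x p) θ ∼ const x *ₚ evalAt p θ
      evalAt-scale x []            = P.sym (P.zeroʳ (const x))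
      evalAt-scale x ((a , α) ∷ p) = P.trans
        (P.+-cong (P.trans (P.*-congʳ {monoSubst α θ} (const-* x a)) (P.*-assoc (const x) (const a) (monoSubst α θ)))
                  (evalAt-scale x p))
        (P.sym (P.distribˡ (const x) (const a *ₚ monoSubst α θ) (evalAt p θ)))

      -- Multiplication by the `j`-th variable of the ring in `d` variables, which evaluation
      -- carries to multiplication by `θ j`.
      shift : Fin d → Poly d → Poly d
      shift j = List.map (λ (a , α) → a , updateAt α j suc)

      evalAt-shift : ∀ j p → evalAt (shift j p) θ ∼ θ j *ₚ evalAt p θ
      evalAt-shift j []            = P.sym (P.zeroʳ (θ j))
      evalAt-shift j ((a , α) ∷ p) = P.trans
        (P.+-cong (P.trans (P.*-congˡ {const a} (monoSubst-suc θ α j)) (x*yz∼y*xz (const a) (θ j) (monoSubst α θ)))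
                  (evalAt-shift j p))
        (P.sym (P.distribˡ (θ j) (const a *ₚ monoSubst α θ) (evalAt p θ)))

    ∑ₚ≡sum : ∀ {m} (f : Fin m → Poly n) → ∑ₚ f ≡ sumₚ f
    ∑ₚ≡sum {zero}  f = ≡.refl
    ∑ₚ≡sum {suc m} f = cong (f zero +ₚ_) (∑ₚ≡sum (f ∘ suc))

    ∑ₚ≈sum : ∀ {m} (f : Fin m → Poly n) → ∑ₚ f ∼ sumₚ f
    ∑ₚ≈sum f = P.reflexive (∑ₚ≡sum f)

    ∑ₚ-cong : ∀ {m} {f g : Fin m → Poly n} → (∀ i → f i ∼ g i) → ∑ₚ f ∼ ∑ₚ g
    ∑ₚ-cong {f = f} {g} f∼g = P.trans (∑ₚ≈sum f) (P.trans (sumₚ-cong-≋ f∼g) (P.sym (∑ₚ≈sum g)))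

    ∑ₚ-single : ∀ {m} {f : Fin m → Poly n} k → (∀ i → i ≢ k → f i ∼ 0ₚ) → ∑ₚ f ∼ f k
    ∑ₚ-single {f = f} k f∼0 = P.trans (∑ₚ≈sum f) (sum-single P.+-commutativeMonoid k f∼0)

    ∑ₚ-zero : ∀ {m} {f : Fin m → Poly n} → (∀ i → f i ∼ 0ₚ) → ∑ₚ f ∼ 0ₚ
    ∑ₚ-zero {f = f} f∼0 = P.trans (∑ₚ≈sum f) (sum-zero P.+-commutativeMonoid f∼0)

    ∑ₚ-+ : ∀ {m} (f g : Fin m → Poly n) → ∑ₚ (λ i → f i +ₚ g i) ∼ ∑ₚ f +ₚ ∑ₚ g
    ∑ₚ-+ f g = P.trans (∑ₚ≈sum (λ i → f i +ₚ g i))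
      (P.trans (∑ₚ-distrib-+ f g) (P.sym (P.+-cong (∑ₚ≈sum f) (∑ₚ≈sum g))))

    *-∑ₚ : ∀ {m} u (f : Fin m → Poly n) → u *ₚ ∑ₚ f ∼ ∑ₚ (λ i → u *ₚ f i)
    *-∑ₚ u f = P.trans (P.*-congˡ {u} (∑ₚ≈sum f))
      (P.trans (*ₚ-distribˡ-sum u f) (P.sym (∑ₚ≈sum (λ i → u *ₚ f i))))

    -- Generation over the parameters modulo the Stanley-Reisner ideal.

    module FiniteGeneration (Δ : Subset n → Set) {d} (θ : Fin d → Poly n) where

      Nonface : Set
      Nonface = ∃[ F ] ¬ Δ F

      -- Members of the ideal are given by lists, so that adding them is concatenation;
      -- `idealElement∈` returns to the indexed form of `InSRIdeal`.
      idealElement : List (Poly n × Nonface) → Poly n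
      idealElement []                 = 0ₚ
      idealElement ((h , F , _) ∷ hs) = (h *ₚ xMon F) +ₚ idealElement hs

      idealElement-++ : ∀ hs hs′ → idealElement (hs ++ hs′) ∼ idealElement hs +ₚ idealElement hs′
      idealElement-++ []                 hs′ = P.refl
      idealElement-++ ((h , F , _) ∷ hs) hs′ = P.trans (P.+-congˡ {h *ₚ xMon F} (idealElement-++ hs hs′))
        (P.sym (P.+-assoc (h *ₚ xMon F) (idealElement hs) (idealElement hs′)))

      *-idealElement : ∀ u hs → u *ₚ idealElement hs ∼ idealElement (List.map (λ (h , F) → u *ₚ h , F) hs)
      *-idealElement u []                 = P.zeroʳ u
      *-idealElement u ((h , F , _) ∷ hs) = P.trans (P.distribˡ u (h *ₚ xMon F) (idealElement hs))
        (P.+-cong (P.sym (P.*-assoc u h (xMon F))) (*-idealElement u hs))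

      idealElement∈ : ∀ hs → idealElement hs ≡ ∑ₚ (λ l → proj₁ (List.lookup hs l) *ₚ xMon (proj₁ (proj₂ (List.lookup hs l))))
      idealElement∈ []       = ≡.refl
      idealElement∈ (t ∷ hs) = cong (_ +ₚ_) (idealElement∈ hs)

      N : ℕ
      N = length (subsets n)

      -- Squarefree monomials of all subsets, faces or not, serve as generators; this way membership
      -- in `Δ` need not be decided.
      g : Fin N → Poly n
      g l = xMon (List.lookup (subsets n) l)

      combination : (Fin N → Poly d) → Poly n
      combination p = ∑ₚ (λ l → evalAt (p l) θ *ₚ g l)

      -- Membership of the class of `f` in the submodule generated by the squarefree monomials over
      -- the subring of the parameters.
      record Rep (f : Poly n) : Set (c ⊔ ℓ) where
        constructor rep
        field
          coeffs  : Fin N → Poly d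
          ideal   : List (Poly n × Nonface)
          decomp  : f ∼ combination coeffs +ₚ idealElement ideal

      rep-∼ : ∀ {f f′} → f ∼ f′ → Rep f′ → Rep f
      rep-∼ f∼f′ (rep p hs eq) = rep p hs (P.trans f∼f′ eq)

      rep-+ : ∀ {f f′} → Rep f → Rep f′ → Rep (f +ₚ f′)
      rep-+ (rep p hs eq) (rep p′ hs′ eq′) = rep (λ l → p l +ₚ p′ l) (hs ++ hs′)
        (P.trans (P.+-cong eq eq′) (P.trans
          (+ₚ-interchange (combination p) (idealElement hs) (combination p′) (idealElement hs′))
          (P.sym (P.+-cong
            (P.trans (∑ₚ-cong λ l → P.trans (P.*-congʳ {g l} (evalAt-++ θ (p l) (p′ l)))
                                            (P.distribʳ (g l) (evalAt (p l) θ) (evalAt (p′ l) θ)))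
                     (∑ₚ-+ (λ l → evalAt (p l) θ *ₚ g l) (λ l → evalAt (p′ l) θ *ₚ g l)))
            (idealElement-++ hs hs′)))))

      -- The map `U` lifts multiplication by `u` to the coefficient polynomials. It is `shift` for a
      -- parameter and `scale` for a constant.
      rep-* : ∀ u (U : Poly d → Poly d) → (∀ p → evalAt (U p) θ ∼ u *ₚ evalAt p θ) →
              ∀ {f} → Rep f → Rep (u *ₚ f)
      rep-* u U evalAt-U (rep p hs eq) = rep (U ∘ p) (List.map (λ (h , F) → u *ₚ h , F) hs)
        (P.trans (P.*-congˡ {u} eq) (P.trans (P.distribˡ u (combination p) (idealElement hs))
          (P.+-cong
            (P.trans (*-∑ₚ u (λ l → evalAt (p l) θ *ₚ g l)) (∑ₚ-cong λ l →
              P.trans (P.sym (P.*-assoc u (evalAt (p l) θ) (g l))) (P.*-congʳ {g l} (P.sym (evalAt-U (p l))))))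
            (*-idealElement u hs))))

      rep-θ : ∀ j {f} → Rep f → Rep (θ j *ₚ f)
      rep-θ j = rep-* (θ j) (shift θ j) (evalAt-shift θ j)

      rep-const : ∀ x {f} → Rep f → Rep (const x *ₚ f)
      rep-const x = rep-* (const x) (scale θ x) (evalAt-scale θ x)

      rep-nonface : ∀ h {F} → ¬ Δ F → Rep (h *ₚ xMon F)
      rep-nonface h {F} ¬ΔF = rep (λ _ → []) ((h , F , ¬ΔF) ∷ [])
        (P.sym (P.trans (P.+-congʳ (∑ₚ-zero {N} {λ _ → 0ₚ} λ _ → P.refl)) (P.+-identityʳ (h *ₚ xMon F))))

      rep-xMon : ∀ F → Rep (xMon F)
      rep-xMon F = rep (λ l → p l (l Fin.≟ k)) [] (P.sym
        (P.trans (P.+-identityʳ (combination (λ l → p l (l Fin.≟ k))))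
          (P.trans (∑ₚ-single k off) (on (k Fin.≟ k)))))
        where
        k = Any.index (∈subsets F)
        p : ∀ l → Dec (l ≡ k) → Poly d
        p l (yes _) = 1ₚ
        p l (no  _) = 0ₚ
        off : ∀ l → l ≢ k → evalAt (p l (l Fin.≟ k)) θ *ₚ g l ∼ 0ₚ
        off l l≢k with l Fin.≟ k
        ... | yes l≡k = contradiction l≡k l≢k
        ... | no  _   = P.refl
        on : ∀ k≟k → evalAt (p k k≟k) θ *ₚ g k ∼ xMon F
        on (yes _)  = P.trans (P.*-congʳ {g k} (evalAt-1 θ)) (P.trans (P.*-identityˡ (g k))
                        (P.reflexive (cong xMon (≡.sym (lookup-index (∈subsets F))))))
        on (no k≢k) = contradiction ≡.refl k≢k

      rep-0 : Rep 0ₚ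
      rep-0 = rep (λ _ → []) []
        (P.sym (P.trans (P.+-identityʳ (combination λ _ → [])) (∑ₚ-zero {N} {λ _ → 0ₚ} λ _ → P.refl)))

      rep-∑ : ∀ {m} {f : Fin m → Poly n} → (∀ i → Rep (f i)) → Rep (∑ₚ f)
      rep-∑ {zero}  _ = rep-0
      rep-∑ {suc m} r = rep-+ (r zero) (rep-∑ (r ∘ suc))

      rep-all : (∀ α → Rep (mono α)) → ∀ f → Rep f
      rep-all r []            = rep-0
      rep-all r ((a , α) ∷ f) = rep-∼ split (rep-+ (rep-const a (r α)) (rep-all r f))
        where
        split : ((a , α) ∷ f) ∼ (const a *ₚ mono α) +ₚ f
        split = ∼-intro λ φ → trans
          (+-congʳ (sym (trans (pair-const a (mono α) φ) (*-congˡ (pair-mono α φ)))))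
          (sym (pair-++ (const a *ₚ mono α) f φ))

      rep⇒FinGenOver : (∀ f → Rep f) → FinGenOver Δ θ
      rep⇒FinGenOver r = N , g , λ f → let rep p hs eq = r f in
        p , length hs , (λ l → proj₁ (List.lookup hs l)) , (λ l → proj₁ (proj₂ (List.lookup hs l))) ,
        (λ l → proj₂ (proj₂ (List.lookup hs l))) ,
        ∼⇒≈ₚ (subtract (combination p) (idealElement hs) eq (idealElement∈ hs))
        where
        subtract : ∀ {f} s t {t′} → f ∼ s +ₚ t → t ≡ t′ → f +ₚ (-ₚ s) ∼ t′
        subtract s t eq ≡.refl = P.trans (P.+-congʳ { -ₚ s} (P.trans eq (P.+-comm s t)))
          (P.trans (P.+-assoc t s (-ₚ s)) (P.trans (P.+-congˡ {t} (P.-‿inverseʳ s)) (P.+-identityʳ t)))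

  -- Reduction of monomials to squarefree ones.

  -- Equivalently, the rows of `a`, restricted to the coordinates in `F`, span the whole coordinate
  -- space of `F`.
  Reducible : ∀ {n d} → (Fin d → Fin n → Carrier) → Subset n → Set (c ⊔ ℓ)
  Reducible {n} {d} a F = ∀ f → f ∈ F → Σ (Fin d → Carrier) λ y →
    ∑ (λ j → y j * a j f) ≈ 1# × (∀ i → i ∈ F → i ≢ f → ∑ (λ j → y j * a j i) ≈ 0#)

  module _ {n d} (Δ : Subset n → Set) (a : Fin d → Fin n → Carrier) where
    private module P = CommutativeRing (polyRing n)
    open FiniteGeneration Δ (linForm ∘ a)

    -- With `v` the combination of the rows given by `y` and `δ` the unit vector at `f`, the
    -- variable at `f` is the form of `v` plus the form of `u = δ - v`. The first is a combination
    -- of parameters and the second involves only variables outside `F`. Multiplying by the monomial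
    -- of `β` gives the claim.
    substitute : ∀ {F} (y : Fin d → Carrier) f →
                 ∑ (λ j → y j * a j f) ≈ 1# → (∀ i → i ∈ F → i ≢ f → ∑ (λ j → y j * a j i) ≈ 0#) →
                 ∀ β → Rep (mono β) → (∀ i → i ∉ F → Rep (mono (updateAt β i suc))) →
                 Rep (mono (updateAt β f suc))
    substitute {F} y f at-f off-f β rβ r↑ = rep-∼ identity
      (rep-+ (rep-∑ λ j → rep-const (y j) (rep-θ j rβ)) (rep-∑ rep-u))
      where
      v δ u : Fin n → Carrier
      v i = ∑ (λ j → y j * a j i)
      δ i with i Fin.≟ f
      ... | yes _ = 1#
      ... | no  _ = 0#
      u i = δ i + - v i

      δ≈v : ∀ i → i ∈ F → δ i ≈ v i
      δ≈v i i∈F with i Fin.≟ f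
      ... | yes ≡.refl = sym at-f
      ... | no  i≢f    = sym (off-f i i∈F i≢f)

      δf : δ f ≈ 1#
      δf with f Fin.≟ f
      ... | yes _  = refl
      ... | no f≢f = contradiction ≡.refl f≢f

      δ-off : ∀ i → i ≢ f → δ i ≈ 0#
      δ-off i i≢f with i Fin.≟ f
      ... | yes i≡f = contradiction i≡f i≢f
      ... | no  _   = refl

      rep-u : ∀ i → Rep (const (u i) *ₚ mono (updateAt β i suc))
      rep-u i with i ∈? F
      ... | no  i∉F = rep-const (u i) (r↑ i i∉F)
      ... | yes i∈F = rep-∼ (∼-intro λ φ → trans (pair-const (u i) (mono (updateAt β i suc)) φ)
        (trans (*-congʳ (trans (+-congʳ (δ≈v i i∈F)) (-‿inverseʳ (v i)))) (zeroˡ _))) rep-0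

      p : Fin d → Poly n
      p j = const (y j) *ₚ (linForm (a j) *ₚ mono β)
      q : Fin n → Poly n
      q i = const (u i) *ₚ mono (updateAt β i suc)

      identity : mono (updateAt β f suc) ∼ ∑ₚ p +ₚ ∑ₚ q
      identity = ∼-intro λ φ → let X = λ i → φ (updateAt β i suc) in sym (begin
        pair (∑ₚ p +ₚ ∑ₚ q) φ
          ≈⟨ pair-++ (∑ₚ p) (∑ₚ q) φ ⟩
        pair (∑ₚ p) φ + pair (∑ₚ q) φ
          ≈⟨ +-cong (pair-∑ₚ p φ) (pair-∑ₚ q φ) ⟩
        ∑ (λ j → pair (p j) φ) + ∑ (λ i → pair (q i) φ)
          ≈⟨ +-cong (∑-cong λ j → trans (pair-const (y j) (linForm (a j) *ₚ mono β) φ)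
                                        (*-congˡ (pair-linForm-mono (a j) β φ)))
                    (∑-cong λ i → trans (pair-const (u i) (mono (updateAt β i suc)) φ)
                                        (*-congˡ (pair-mono (updateAt β i suc) φ))) ⟩
        ∑ (λ j → y j * ∑ (λ i → a j i * X i)) + ∑ (λ i → u i * X i)
          ≈⟨ +-congʳ (∑-cong λ j → trans (*-∑ (y j) (λ i → a j i * X i)) (∑-cong λ i → sym (*-assoc (y j) (a j i) (X i)))) ⟩
        ∑ (λ j → ∑ (λ i → (y j * a j i) * X i)) + ∑ (λ i → u i * X i)
          ≈⟨ +-congʳ (∑-swap (λ j i → (y j * a j i) * X i)) ⟩
        ∑ (λ i → ∑ (λ j → (y j * a j i) * X i)) + ∑ (λ i → u i * X i)
          ≈⟨ +-congʳ (∑-cong λ i → sym (∑-* (λ j → y j * a j i) (X i))) ⟩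
        ∑ (λ i → v i * X i) + ∑ (λ i → u i * X i)
          ≈⟨ ∑-+ (λ i → v i * X i) (λ i → u i * X i) ⟨
        ∑ (λ i → v i * X i + u i * X i)
          ≈⟨ ∑-cong (λ i → trans (sym (distribʳ (X i) (v i) (u i))) (*-congʳ (v+u i))) ⟩
        ∑ (λ i → δ i * X i)
          ≈⟨ ∑-single f (λ i i≢f → trans (*-congʳ (δ-off i i≢f)) (zeroˡ (X i))) ⟩
        δ f * X f
          ≈⟨ trans (*-congʳ δf) (*-identityˡ (X f)) ⟩
        X f
          ≈⟨ pair-mono (updateAt β f suc) φ ⟨
        pair (mono (updateAt β f suc)) φ ∎)
        where
        v+u : ∀ i → v i + (δ i + - v i) ≈ δ i
        v+u i = begin
          v i + (δ i + - v i)   ≈⟨ +-congˡ (+-comm (δ i) (- v i)) ⟩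
          v i + (- v i + δ i)   ≈⟨ +-assoc (v i) (- v i) (δ i) ⟨
          (v i + - v i) + δ i   ≈⟨ +-congʳ (-‿inverseʳ (v i)) ⟩
          0# + δ i              ≈⟨ +-identityˡ (δ i) ⟩
          δ i                   ∎

    -- A monomial lies in the ideal, is a generator, or has a square factor that `substitute` trades
    -- away. The trade leads to a lower degree (`lower`) or to the same degree with larger support
    -- (`raise`).
    rep-step : (∀ F → Reducible a F ⊎ ¬ Δ F) → ∀ α →
      (∀ β → suc (Vec.sum β) ≡ Vec.sum α → Rep (mono β)) →
      (∀ γ → Vec.sum γ ≡ Vec.sum α → ∣ supp α ∣ < ∣ supp γ ∣ → Rep (mono γ)) →
      Rep (mono α)
    rep-step reducible α lower raise with reducible (supp α)
    ... | inj₂ ¬Δ = rep-∼ (∼-intro λ φ → sym (trans (pair-*ₚ (mono (Vec.map ℕ.pred α)) (xMon (supp α)) φ)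
            (trans (pair-mono (Vec.map ℕ.pred α) (λ β → pair (xMon (supp α)) (φ ∘ zipWith _+ℕ_ β)))
              (trans (pair-mono (Vec.map bit (supp α)) (φ ∘ zipWith _+ℕ_ (Vec.map ℕ.pred α)))
              (trans (reflexive (cong φ (divide-supp α))) (sym (pair-mono α φ)))))))
            (rep-nonface (mono (Vec.map ℕ.pred α)) ¬Δ)
    ... | inj₁ red with Finₚ.any? (λ i → 2 ℕ.≤? lookup α i)
    ...   | no none = rep-∼ (P.reflexive (cong mono (squarefree α λ i le → none (i , le)))) (rep-xMon (supp α))
    ...   | yes (f , 2≤αf) with lower-exponent α f 2≤αf
    ...     | β , ≡.refl , suppβ with red f (∈supp α 2≤αf)
    ...       | y , at-f , off-f = substitute y f at-f off-f β
      (lower β (≡.sym (sum-suc β f)))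
      λ i i∉F → raise (updateAt β i suc) (≡.trans (sum-suc β i) (≡.sym (sum-suc β f)))
        (ℕₚ.≤-reflexive (≡.sym (≡.trans (cong ∣_∣ (supp-suc β i))
          (≡.trans (∣p∪⁅x⁆∣≡1+∣p∣ (supp β) (subst (i ∉_) (≡.sym suppβ) i∉F)) (cong (suc ∘ ∣_∣) suppβ)))))

    reducible⇒FinGenOver : (∀ F → Reducible a F ⊎ ¬ Δ F) → FinGenOver Δ (linForm ∘ a)
    reducible⇒FinGenOver reducible = rep⇒FinGenOver (rep-all λ α → go (Vec.sum α) n α ≡.refl (ℕₚ.m≤n+m n _))
      where
      -- Lexicographic induction: `D` is the degree and `k` bounds the number of variables missing
      -- from the support. When the degree drops, `k` is reset to `n`; at `k = 0` the support is
      -- full and cannot grow.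
      go : ∀ D k (α : Vec ℕ n) → Vec.sum α ≡ D → n ≤ ∣ supp α ∣ +ℕ k → Rep (mono α)
      raise : ∀ D k (α : Vec ℕ n) → Vec.sum α ≡ D → n ≤ ∣ supp α ∣ +ℕ k →
              ∀ γ → Vec.sum γ ≡ Vec.sum α → ∣ supp α ∣ < ∣ supp γ ∣ → Rep (mono γ)
      go zero    k α eq le = rep-step reducible α (λ β eq′ → contradiction (≡.trans eq′ eq) λ ()) (raise zero k α eq le)
      go (suc D) k α eq le = rep-step reducible α
        (λ β eq′ → go D n β (ℕₚ.suc-injective (≡.trans eq′ eq)) (ℕₚ.m≤n+m n _)) (raise (suc D) k α eq le)
      raise D zero    α eq le γ eq′ lt = contradiction (∣p∣≤n (supp γ))
        (ℕₚ.<⇒≱ (ℕₚ.≤-<-trans (subst (n ≤_) (ℕₚ.+-identityʳ _) le) lt))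
      raise D (suc k) α eq le γ eq′ lt = go D k γ (≡.trans eq′ eq)
        (ℕₚ.≤-trans le (ℕₚ.≤-trans (ℕₚ.≤-reflexive (ℕₚ.+-suc _ k)) (ℕₚ.+-monoˡ-≤ k lt)))

-- The row space of the signed fundamental cocircuits and the two complexes.

↑ʳ∈lastBlock : ∀ m {r} (j : Fin r) → m ↑ʳ j ∈ lastBlock m r
↑ʳ∈lastBlock m {r} j = lookup⇒[]= _ _ (≡.trans (lookup-++ʳ (replicate m false) _ j) (lookup-replicate j true))

∈lastBlock⁻ : ∀ m {r} {i : Fin (m +ℕ r)} → i ∈ lastBlock m r → ∃[ j ] i ≡ m ↑ʳ j
∈lastBlock⁻ m {r} {i} i∈ with splitAt m i in eq
... | inj₂ j = j , ≡.sym (Finₚ.splitAt⁻¹-↑ʳ eq)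
... | inj₁ j with ≡.trans (≡.sym ([]=⇒lookup i∈)) (≡.trans (cong (lookup (lastBlock m r)) (≡.sym (Finₚ.splitAt⁻¹-↑ˡ eq)))
                    (≡.trans (lookup-++ˡ (replicate m false) _ j) (lookup-replicate j false)))
...   | ()

∣lastBlock∣ : ∀ m r → ∣ lastBlock m r ∣ ≡ r
∣lastBlock∣ zero    r = ∣⊤∣≡n r
∣lastBlock∣ (suc m) r = ∣lastBlock∣ m r

module _ {c ℓ} (K : Field c ℓ) where
  open Field K hiding (zero)
  open OverField K
  open SetoidReasoning setoid
  open import Algebra.Properties.Ring ring using (-‿distribˡ-*; -‿involutive; -‿distribʳ-*)
  open import Algebra.Properties.Group +-group using () renaming (x∙y⁻¹≈ε⇒x≈y to x-y≈0⇒x≈y)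
  open import Algebra.Properties.CommutativeSemigroup *-commutativeSemigroup using (x∙yz≈y∙xz)

  signVal² : ∀ s → signVal s * signVal s ≈ 1#
  signVal² Sign.+ = *-identityˡ 1#
  signVal² Sign.- = trans (sym (-‿distribˡ-* 1# (- 1#)))
    (trans (-‿cong (*-identityˡ (- 1#))) (-‿involutive 1#))

  module _ {n : ℕ} (σ : Signing n) where
    entry-∉ : ∀ {C i} → i ∉ C → entry σ C i ≈ 0#
    entry-∉ {C} {i} i∉C with lookup C i in eq
    ... | false = refl
    ... | true  = contradiction (lookup⇒[]= i C eq) i∉C

    entry² : ∀ {C i} → i ∈ C → entry σ C i * entry σ C i ≈ 1#
    entry² {C} {i} i∈C with lookup C i in eq
    ... | true  = signVal² (σ C i)
    ... | false = contradiction (≡.trans (≡.sym ([]=⇒lookup i∈C)) eq) λ ()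

  module _ {m r : ℕ} (M : Matroid (m +ℕ r)) (indep? : ∀ X → Dec (Matroid.Indep M X))
           (basis : IsBasis M (lastBlock m r))
           (σ : Signing (m +ℕ r)) (adm : Admissible M σ)
           (coc : Fin r → Subset (m +ℕ r))
           (fund : ∀ j → IsFundCocircuit M (lastBlock m r) (m ↑ʳ j) (coc j)) where
    open Matroid M

    private
      B = lastBlock m r
      τ = proj₁ adm
      a : Fin r → Fin (m +ℕ r) → Carrier
      a j i = entry σ (coc j) i

    coc∩basis : ∀ j {i} → i ∈ coc j → i ∈ B → i ≡ m ↑ʳ j
    coc∩basis j i∈C i∈B with x∈p∪⁅y⁆⁻ (∁ B) (proj₂ (fund j) i∈C)
    ... | inj₁ i∈∁B = contradiction i∈B (x∈∁p⇒x∉p i∈∁B)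
    ... | inj₂ i≡   = i≡

    -- Otherwise `coc j` would be disjoint from the basis `B` and hence independent in the dual.
    ↑ʳ∈coc : ∀ j → m ↑ʳ j ∈ coc j
    ↑ʳ∈coc j = decidable-stable (m ↑ʳ j ∈? coc j) λ b∉C →
      proj₁ (proj₁ (fund j)) (B , basis , λ {i} i∈C → x∉p⇒x∈∁p λ i∈B →
        b∉C (subst (_∈ coc j) (coc∩basis j i∈C i∈B) i∈C))

    fundamental-rows-offDiagonal : ∀ {j j′} → j ≢ j′ → a j (m ↑ʳ j′) ≈ 0#
    fundamental-rows-offDiagonal {j} {j′} j≢j′ = entry-∉ σ λ j′∈C →
      j≢j′ (≡.sym (Finₚ.↑ʳ-injective m j′ j (coc∩basis j j′∈C (↑ʳ∈lastBlock m j′))))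

    -- The difference of both sides vanishes on B and is orthogonal to the
    -- fundamental circuits of B, whose off-basis parts are ± unit vectors.
    cocircuit∈rowspace : ∀ {C} → IsCocircuit M C → ∃[ y ] ∀ i → ∑ (λ j → y j * a j i) ≈ entry σ C i
    cocircuit∈rowspace {C} coC = y , λ i → [ on-basis i , off-basis i ]′ (∈B? i)
      where
      w v : Fin (m +ℕ r) → Carrier
      w = entry σ C
      y : Fin r → Carrier
      -- On `B` the fundamental rows form a diagonal matrix of signs. A sign is its own inverse, so
      -- dividing by the diagonal entry is multiplying by it.
      y j = w (m ↑ʳ j) * a j (m ↑ʳ j)
      v i = ∑ (λ j → y j * a j i)

      ∈B? : ∀ i → i ∈ B ⊎ i ∉ B
      ∈B? i with i ∈? B
      ... | yes i∈B = inj₁ i∈B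
      ... | no  i∉B = inj₂ i∉B

      on-basis : ∀ i → i ∈ B → v i ≈ w i
      on-basis i i∈B with ∈lastBlock⁻ m i∈B
      ... | k , ≡.refl = begin
        ∑ (λ j → y j * a j (m ↑ʳ k))
          ≈⟨ ∑-single K k (λ j j≢k → trans (*-congˡ (fundamental-rows-offDiagonal j≢k)) (zeroʳ (y j))) ⟩
        (w (m ↑ʳ k) * a k (m ↑ʳ k)) * a k (m ↑ʳ k)
          ≈⟨ *-assoc _ _ _ ⟩
        w (m ↑ʳ k) * (a k (m ↑ʳ k) * a k (m ↑ʳ k))
          ≈⟨ *-congˡ (entry² σ (↑ʳ∈coc k)) ⟩
        w (m ↑ʳ k) * 1#
          ≈⟨ *-identityʳ _ ⟩
        w (m ↑ʳ k) ∎

      off-basis : ∀ e → e ∉ B → v e ≈ w e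
      -- Orthogonality to the circuit `D` leaves only the term at `e`, and the sign `t e` cancels
      -- against itself.
      off-basis e e∉B = x-y≈0⇒x≈y (v e) (w e) (begin
          d e               ≈⟨ *-identityˡ (d e) ⟨
          1# * d e          ≈⟨ *-congʳ (entry² τ e∈D) ⟨
          (t e * t e) * d e ≈⟨ *-assoc (t e) (t e) (d e) ⟩
          t e * (t e * d e) ≈⟨ *-congˡ (∑-single K e single) ⟨
          t e * ∑ (λ l → t l * d l) ≈⟨ *-congˡ t⊥d ⟩
          t e * 0#          ≈⟨ zeroʳ (t e) ⟩
          0#                ∎)
        where
        circuit = fundamental-circuit M indep? basis e∉B
        D = proj₁ circuit
        D⊆ = proj₁ (proj₂ circuit)
        e∈D = proj₁ (proj₂ (proj₂ circuit))
        ciD = proj₂ (proj₂ (proj₂ circuit))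
        t d : Fin (m +ℕ r) → Carrier
        t = entry τ D
        d l = v l + - w l

        single : ∀ l → l ≢ e → t l * d l ≈ 0#
        single l l≢e with l ∈? D
        ... | no l∉D = trans (*-congʳ (entry-∉ τ l∉D)) (zeroˡ (d l))
        ... | yes l∈D with x∈p∪⁅y⁆⁻ B (D⊆ l∈D)
        ...   | inj₁ l∈B = trans (*-congˡ (trans (+-congʳ (on-basis l l∈B)) (-‿inverseʳ (w l)))) (zeroʳ (t l))
        ...   | inj₂ l≡e = contradiction l≡e l≢e

        t⊥v : ∑ (λ l → t l * v l) ≈ 0#
        t⊥v = begin
          ∑ (λ l → t l * v l)
            ≈⟨ ∑-cong K (λ l → *-∑ K (t l) (λ j → y j * a j l)) ⟩
          ∑ (λ l → ∑ (λ j → t l * (y j * a j l)))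
            ≈⟨ ∑-swap K (λ l j → t l * (y j * a j l)) ⟩
          ∑ (λ j → ∑ (λ l → t l * (y j * a j l)))
            ≈⟨ ∑-cong K (λ j → ∑-cong K λ l → x∙yz≈y∙xz (t l) (y j) (a j l)) ⟩
          ∑ (λ j → ∑ (λ l → y j * (t l * a j l)))
            ≈⟨ ∑-cong K (λ j → *-∑ K (y j) (λ l → t l * a j l)) ⟨
          ∑ (λ j → y j * ∑ (λ l → t l * a j l))
            ≈⟨ ∑-zero K (λ j → trans (*-congˡ (proj₂ adm D (coc j) ciD (proj₁ (fund j)))) (zeroʳ (y j))) ⟩
          0# ∎

        t⊥d : ∑ (λ l → t l * d l) ≈ 0#
        t⊥d = begin
          ∑ (λ l → t l * d l)
            ≈⟨ ∑-cong K (λ l → trans (distribˡ (t l) (v l) (- w l)) (+-congˡ (trans (sym (-‿distribʳ-* (t l) (w l))) (-1*w l)))) ⟩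
          ∑ (λ l → t l * v l + - 1# * (t l * w l))
            ≈⟨ ∑-+ K (λ l → t l * v l) (λ l → - 1# * (t l * w l)) ⟩
          ∑ (λ l → t l * v l) + ∑ (λ l → - 1# * (t l * w l))
            ≈⟨ +-cong t⊥v (sym (*-∑ K (- 1#) (λ l → t l * w l))) ⟩
          0# + - 1# * ∑ (λ l → t l * w l)
            ≈⟨ trans (+-identityˡ _) (*-congˡ (proj₂ adm D C ciD coC)) ⟩
          - 1# * 0#
            ≈⟨ zeroʳ (- 1#) ⟩
          0# ∎
          where
          -1*w : ∀ l → - (t l * w l) ≈ - 1# * (t l * w l)
          -1*w l = trans (-‿cong (sym (*-identityˡ _))) (-‿distribˡ-* 1# _)

    independent⇒reducible : ∀ {F} → Indep F → Reducible K a F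
    independent⇒reducible {F} iF f f∈F with extend-to-basis M basis iF
    ... | B′ , F⊆B′ , basis′ with fundamental-cocircuit M indep? basis′ (F⊆B′ f∈F)
    ...   | C , f∈C , C∩B′ , coC with cocircuit∈rowspace coC
    ...     | y , y≈ = (λ j → s * y j) ,
      trans (scaled f) (entry² σ f∈C) ,
      λ i i∈F i≢f → trans (scaled i) (trans (*-congˡ (entry-∉ σ λ i∈C → i≢f (C∩B′ i∈C (F⊆B′ i∈F)))) (zeroʳ s))
      where
      -- A sign, so scaling by it makes the coefficient at `f` equal to 1.
      s = entry σ C f
      scaled : ∀ i → ∑ (λ j → (s * y j) * a j i) ≈ s * entry σ C i
      scaled i = begin
        ∑ (λ j → (s * y j) * a j i)   ≈⟨ ∑-cong K (λ j → *-assoc s (y j) (a j i)) ⟩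
        ∑ (λ j → s * (y j * a j i))   ≈⟨ *-∑ K s (λ j → y j * a j i) ⟨
        s * ∑ (λ j → y j * a j i)     ≈⟨ *-congˡ (y≈ i) ⟩
        s * entry σ C i               ∎

    -- `Reducible` does not mention `Δ`, so the independent sets can be treated once for both
    -- complexes; dependent sets must only be nonfaces.
    finGenOver : (Δ : Subset (m +ℕ r) → Set) → (∀ {F} → ¬ Indep F → ¬ Δ F) →
                 FinGenOver Δ (λ j → linForm (a j))
    finGenOver Δ ⊆Indep = reducible⇒FinGenOver K Δ a λ F → cases F (indep? F)
      where
      cases : ∀ F → Dec (Indep F) → Reducible K a F ⊎ ¬ Δ F
      cases F (yes iF) = inj₁ (independent⇒reducible iF)
      cases F (no ¬iF) = inj₂ (⊆Indep ¬iF)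

    size≤r : ∀ {F} → Indep F → ∣ F ∣ ≤ r
    size≤r iF = ℕₚ.≤-trans (indep-size M basis iF) (ℕₚ.≤-reflexive (∣lastBlock∣ m r))

    indepComplex-lsop : IsLSOP (IndepComplex M) a
    indepComplex-lsop =
      ((λ F → size≤r) , B , proj₁ basis , ∣lastBlock∣ m r) , finGenOver (IndepComplex M) (λ ¬iF → ¬iF)

    bcComplex-lsop : Loopless M → IsLSOP (BCComplex M) a
    bcComplex-lsop loopless with lexfirst-exists M indep?
    ... | F , iF , lex =
      -- Faces are independent because a dependent set contains a circuit and with it a broken
      -- circuit; the greedy basis attains the bound.
      ( (λ F bc → size≤r (decidable-stable (indep? F) λ ¬iF → dependent⇒∉BC M indep? ¬iF bc))
      , F , lexfirst∈BC M indep? loopless iF lex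
      , ≡.trans (lexfirst-size M indep? basis iF lex) (∣lastBlock∣ m r)) ,
      finGenOver (BCComplex M) (dependent⇒∉BC M indep?)

open import Data.Nat using (_+_)

theorem3p7 : ∀ {c ℓ} (K : Field c ℓ) (m r : ℕ) (M : Matroid (m + r)) →
    Regular M →
    IsBasis M (lastBlock m r) →
    (σ : OverField.Signing K (m + r)) → OverField.Admissible K M σ →
    (coc : Fin r → Subset (m + r)) →
    (∀ j → IsFundCocircuit M (lastBlock m r) (m ↑ʳ j) (coc j)) →
    OverField.IsLSOP K (IndepComplex M) (λ j i → OverField.entry K σ (coc j) i)
    × (Loopless M → OverField.IsLSOP K (BCComplex M) (λ j i → OverField.entry K σ (coc j) i))
theorem3p7 K m r M regular basis σ adm coc fund =
  let indep? = regular⇒indep? M regular in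
  indepComplex-lsop K M indep? basis σ adm coc fund , bcComplex-lsop K M indep? basis σ adm coc fund
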